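{- Let $G$ be a countably infinite discrete group and let $X$ be an aperiodic Polish $G$-space. Then there is a $G$-invariant comeager Borel set $D\subseteq X$ such that the Borel $G$-space $D$ admits a $4$-generator.
   Context: A Polish $G$-space is a Polish space equipped with a continuous action of $G$; it is aperiodic if every $G$-orbit is infinite. A Borel $G$-space is a standard Borel space equipped with a Borel action of $G$. A $k$-generator for a Borel $G$-space $D$ is a partition $\{A_n\}_{n<k}$ of $D$ into Borel sets (pieces may be empty) such that $\{gA_n : g\in G, n<k\}$ generates the Borel $\sigma$-algebra of $D$. -}

module Defs where

open import Algebra.Bundles using (Group)
open import Algebra.Core using (Op₂)
open import Data.Fin.Base using (Fin)
open import Data.Nat.Base using (ℕ)
import Data.Nat.Base as ℕ
open import Data.Product.Base using (Σ; ∃; ∃₂; _×_; _,_; proj₁; proj₂)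
open import Data.Product.Relation.Binary.Pointwise.NonDependent using (×-setoid)
open import Data.Rational.Base using (ℚ; 0ℚ; _+_; _<_; _≤_)
import Data.Rational.Properties as ℚ
open import Data.Unit.Polymorphic.Base using (⊤; tt)
open import Function.Bundles using (Bijection; Injection; _⇔_)
open import Function.Metric.Structures using (IsGeneralMetric)
open import Level using (Level; 0ℓ; suc; _⊔_; Lift; lift; lower)
open import Relation.Binary.Bundles using (Setoid)
open import Relation.Binary.Core using (Rel)
open import Relation.Binary.Definitions using (_Respects_)
open import Relation.Binary.PropositionalEquality.Core using (_≡_)
import Relation.Binary.PropositionalEquality.Properties as ≡
import Relation.Binary.Construct.On as On
open import Relation.Nullary.Negation.Core using (¬_)
open import Relation.Unary using (Pred; _∈_; _⊆_; _≐_; _∩_; _⊥_; _≬_; _⊢_; ∁; ⋃; Empty; Universal; Satisfiable)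
open import Relation.Unary.Properties using (≐-refl; ≐-sym; ≐-trans)

------------------------------------------------------------------------
-- Cardinality

module _ {a ℓ : Level} where

  Finite : Setoid a ℓ → Set (a ⊔ ℓ)
  Finite S = ∃ λ n → Bijection S (≡.setoid (Fin n))

  Infinite : Setoid a ℓ → Set (a ⊔ ℓ)
  Infinite S = ¬ Finite S

  Countable : Setoid a ℓ → Set (a ⊔ ℓ)
  Countable S = Injection S (≡.setoid ℕ)

  CountablyInfinite : Setoid a ℓ → Set (a ⊔ ℓ)
  CountablyInfinite S = Bijection S (≡.setoid ℕ)

subsetoid : ∀ {a ℓ p} (S : Setoid a ℓ) → Pred (Setoid.Carrier S) p → Setoid (a ⊔ p) ℓ
subsetoid S P = On.setoid S (proj₁ {B = P})

------------------------------------------------------------------------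
-- Nonnegative reals

-- A nonnegative real r is represented by its upper Dedekind cut
-- { q ∈ ℚ | r < q }.  Classically r ↦ { q | r < q } is a bijection from
-- [0, ∞) onto the sets of rationals with the four properties below.

record ℝ≥0 : Set₁ where
  field
    cut       : Pred ℚ 0ℓ
    inhabited : Satisfiable cut
    positive  : ∀ {q} → q ∈ cut → 0ℚ < q
    upward    : ∀ {p q} → p ∈ cut → p < q → q ∈ cut
    rounded   : ∀ {q} → q ∈ cut → ∃ λ p → p < q × p ∈ cut

open ℝ≥0 public using (cut)

infix  4 _≈ᵣ_ _≤ᵣ_ _<ᵣ_
infixl 6 _+ᵣ_

_≈ᵣ_ : Rel ℝ≥0 0ℓ
x ≈ᵣ y = cut x ≐ cut y

_≤ᵣ_ : Rel ℝ≥0 0ℓ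
x ≤ᵣ y = cut y ⊆ cut x

_<ᵣ_ : ℝ≥0 → ℚ → Set
x <ᵣ q = q ∈ cut x

0ᵣ : ℝ≥0
0ᵣ = record
  { cut       = 0ℚ <_
  ; inhabited = _ , ℚ.positive⁻¹ 1ℚ
  ; positive  = λ 0<q → 0<q
  ; upward    = ℚ.<-trans
  ; rounded   = λ 0<q → let m , 0<m , m<q = ℚ.<-dense 0<q in m , m<q , 0<m
  }
  where open import Data.Rational.Base using (1ℚ)

_+ᵣ_ : Op₂ ℝ≥0
x +ᵣ y = record
  { cut       = λ r → ∃₂ λ p q → x <ᵣ p × y <ᵣ q × p + q ≤ r
  ; inhabited = let p , x<p = X.inhabited ; q , y<q = Y.inhabited
                in p + q , p , q , x<p , y<q , ℚ.≤-refl
  ; positive  = λ (p , q , x<p , y<q , p+q≤r) →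
                  ℚ.<-≤-trans (ℚ.+-mono-< (X.positive x<p) (Y.positive y<q)) p+q≤r
  ; upward    = λ (p , q , x<p , y<q , p+q≤r) r<s →
                  p , q , x<p , y<q , ℚ.≤-trans p+q≤r (ℚ.<⇒≤ r<s)
  ; rounded   = λ (p , q , x<p , y<q , p+q≤r) → let p′ , p′<p , x<p′ = X.rounded x<p in
                  p′ + q , ℚ.<-≤-trans (ℚ.+-monoˡ-< q p′<p) p+q≤r ,
                  p′ , q , x<p′ , y<q , ℚ.≤-refl
  }
  where module X = ℝ≥0 x
        module Y = ℝ≥0 y

------------------------------------------------------------------------
-- Topological spaces

-- Families of opens indexed by I : Set ℓ cover the unions of arbitrary
-- families of opens, as classically any such union of subsets of the
-- carrier can be reindexed by the points of the union.

record TopologicalSpace (ℓ : Level) : Set (suc (suc ℓ)) where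
  field
    setoid : Setoid ℓ ℓ

  open Setoid setoid public

  field
    IsOpen    : Pred (Pred Carrier ℓ) (suc ℓ)
    open-resp : ∀ {U} → IsOpen U → U Respects _≈_
    open-≐    : ∀ {U V} → U ≐ V → IsOpen U → IsOpen V
    open-⊤    : IsOpen (λ _ → ⊤)
    open-∩    : ∀ {U V} → IsOpen U → IsOpen V → IsOpen (U ∩ V)
    open-⋃    : ∀ {I : Set ℓ} {U : I → Pred Carrier ℓ} →
                (∀ i → IsOpen (U i)) → IsOpen (⋃ I U)

discrete : ∀ {ℓ} → Setoid ℓ ℓ → TopologicalSpace ℓ
discrete {ℓ} S = record
  { setoid    = S
  ; IsOpen    = λ U → Lift (suc ℓ) (U Respects (Setoid._≈_ S))
  ; open-resp = lower
  ; open-≐    = λ (U⊆V , V⊆U) (lift r) → lift λ x≈y x∈V → U⊆V (r x≈y (V⊆U x∈V))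
  ; open-⊤    = lift λ _ _ → tt
  ; open-∩    = λ (lift r) (lift s) → lift λ x≈y (x∈U , x∈V) → r x≈y x∈U , s x≈y x∈V
  ; open-⋃    = λ r → lift λ x≈y (i , x∈Uᵢ) → i , lower (r i) x≈y x∈Uᵢ
  }

_×ₜ_ : ∀ {ℓ} → TopologicalSpace ℓ → TopologicalSpace ℓ → TopologicalSpace ℓ
_×ₜ_ {ℓ} X Y = record
  { setoid    = ×-setoid X.setoid Y.setoid
  ; IsOpen    = Open
  ; open-resp = λ oW (x≈x′ , y≈y′) xy∈W →
                  let U , V , oU , oV , x∈U , y∈V , UV⊆W = oW xy∈W
                  in UV⊆W (X.open-resp oU x≈x′ x∈U) (Y.open-resp oV y≈y′ y∈V)
  ; open-≐    = λ (W⊆W′ , W′⊆W) oW xy∈W′ →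
                  let U , V , oU , oV , x∈U , y∈V , UV⊆W = oW (W′⊆W xy∈W′)
                  in U , V , oU , oV , x∈U , y∈V , λ p q → W⊆W′ (UV⊆W p q)
  ; open-⊤    = λ _ → _ , _ , X.open-⊤ , Y.open-⊤ , tt , tt , λ _ _ → tt
  ; open-∩    = λ oW oW′ (xy∈W , xy∈W′) →
                  let U  , V  , oU  , oV  , x∈U  , y∈V  , UV⊆W   = oW xy∈W
                      U′ , V′ , oU′ , oV′ , x∈U′ , y∈V′ , UV⊆W′ = oW′ xy∈W′
                  in U ∩ U′ , V ∩ V′ , X.open-∩ oU oU′ , Y.open-∩ oV oV′ ,
                     (x∈U , x∈U′) , (y∈V , y∈V′) ,
                     λ (p , p′) (q , q′) → UV⊆W p q , UV⊆W′ p′ q′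
  ; open-⋃    = λ oW (i , xy∈Wᵢ) →
                  let U , V , oU , oV , x∈U , y∈V , UV⊆W = oW i xy∈Wᵢ
                  in U , V , oU , oV , x∈U , y∈V , λ p q → i , UV⊆W p q
  }
  where
  module X = TopologicalSpace X
  module Y = TopologicalSpace Y
  Open : Pred (Pred (X.Carrier × Y.Carrier) ℓ) (suc ℓ)
  Open W = ∀ {x y} → W (x , y) → ∃₂ λ U V →
    X.IsOpen U × Y.IsOpen V × x ∈ U × y ∈ V × (∀ {x′ y′} → x′ ∈ U → y′ ∈ V → W (x′ , y′))

Continuous : ∀ {ℓ} (X Y : TopologicalSpace ℓ) →
             (TopologicalSpace.Carrier X → TopologicalSpace.Carrier Y) → Set (suc ℓ)
Continuous X Y f = ∀ {U} → TopologicalSpace.IsOpen Y U → TopologicalSpace.IsOpen X (f ⊢ U)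

module _ {ℓ : Level} (X : TopologicalSpace ℓ) where
  open TopologicalSpace X

  Closure : ∀ {p} → Pred Carrier p → Pred Carrier (suc ℓ ⊔ p)
  Closure A x = ∀ {U} → IsOpen U → x ∈ U → U ≬ A

  Interior : ∀ {p} → Pred Carrier p → Pred Carrier (suc ℓ ⊔ p)
  Interior A x = ∃ λ U → IsOpen U × x ∈ U × U ⊆ A

  Dense : Pred Carrier ℓ → Set (suc ℓ)
  Dense A = Universal (Closure A)

  NowhereDense : Pred Carrier ℓ → Set (suc ℓ)
  NowhereDense A = Empty (Interior (Closure A))

  Meager : Pred Carrier ℓ → Set (suc ℓ)
  Meager A = ∃ λ (N : ℕ → Pred Carrier ℓ) → (∀ n → NowhereDense (N n)) × A ≐ ⋃ ℕ N

  Comeager : Pred Carrier ℓ → Set (suc ℓ)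
  Comeager A = Meager (∁ A)

  Separable : Set (suc ℓ)
  Separable = ∃ λ (Q : Pred Carrier ℓ) → Countable (subsetoid setoid Q) × Dense Q

------------------------------------------------------------------------
-- Metrics and Polish spaces

record Metric {a ℓ} (S : Setoid a ℓ) : Set (suc 0ℓ ⊔ a ⊔ ℓ) where
  open Setoid S
  field
    d               : Carrier → Carrier → ℝ≥0
    isGeneralMetric : IsGeneralMetric _≈_ _≈ᵣ_ _≤ᵣ_ 0ᵣ _+ᵣ_ d

  open IsGeneralMetric isGeneralMetric public using (0⇒≈; ≈⇒0; sym; triangle)

  Ball : Carrier → ℚ → Pred Carrier 0ℓ
  Ball x ε y = d x y <ᵣ ε

  MetricOpen : ∀ {p} → Pred Carrier p → Set (a ⊔ p)
  MetricOpen U = ∀ {x} → x ∈ U → ∃ λ ε → 0ℚ < ε × Ball x ε ⊆ U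

  Cauchy : (ℕ → Carrier) → Set
  Cauchy s = ∀ ε → 0ℚ < ε → ∃ λ N → ∀ {m n} → N ℕ.≤ m → N ℕ.≤ n → d (s m) (s n) <ᵣ ε

  _ConvergesTo_ : (ℕ → Carrier) → Carrier → Set
  s ConvergesTo x = ∀ ε → 0ℚ < ε → ∃ λ N → ∀ {n} → N ℕ.≤ n → d (s n) x <ᵣ ε

  Complete : Set a
  Complete = ∀ s → Cauchy s → ∃ λ x → s ConvergesTo x

record IsPolish {ℓ} (X : TopologicalSpace ℓ) : Set (suc ℓ) where
  open TopologicalSpace X using (setoid; IsOpen)
  field
    separable  : Separable X
    metric     : Metric setoid
    complete   : Metric.Complete metric
    compatible : ∀ U → IsOpen U ⇔ Metric.MetricOpen metric U

------------------------------------------------------------------------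
-- σ-algebras

record MeasurableSpace (ℓ : Level) : Set (suc (suc ℓ)) where
  field
    setoid : Setoid ℓ ℓ

  open Setoid setoid public

  field
    Measurable   : Pred (Pred Carrier ℓ) (suc ℓ)
    measurable-≐ : ∀ {A B} → A ≐ B → Measurable A → Measurable B
    measurable-⊤ : Measurable (λ _ → ⊤)
    measurable-∁ : ∀ {A} → Measurable A → Measurable (∁ A)
    measurable-⋃ : ∀ {A : ℕ → Pred Carrier ℓ} → (∀ n → Measurable (A n)) → Measurable (⋃ ℕ A)

data σ⟨_⟩ {a ℓ c} {X : Set a} (𝒞 : Pred (Pred X ℓ) c) : Pred (Pred X ℓ) (a ⊔ suc ℓ ⊔ c) where
  generator : ∀ {A} → A ∈ 𝒞 → A ∈ σ⟨ 𝒞 ⟩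
  σ-≐       : ∀ {A B} → A ≐ B → A ∈ σ⟨ 𝒞 ⟩ → B ∈ σ⟨ 𝒞 ⟩
  σ-⊤       : (λ _ → ⊤) ∈ σ⟨ 𝒞 ⟩
  σ-∁       : ∀ {A} → A ∈ σ⟨ 𝒞 ⟩ → ∁ A ∈ σ⟨ 𝒞 ⟩
  σ-⋃       : ∀ {A : ℕ → Pred X ℓ} → (∀ n → A n ∈ σ⟨ 𝒞 ⟩) → ⋃ ℕ A ∈ σ⟨ 𝒞 ⟩

borel : ∀ {ℓ} → TopologicalSpace ℓ → MeasurableSpace ℓ
borel X = record
  { setoid       = setoid
  ; Measurable   = σ⟨ IsOpen ⟩
  ; measurable-≐ = σ-≐
  ; measurable-⊤ = σ-⊤
  ; measurable-∁ = σ-∁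
  ; measurable-⋃ = σ-⋃
  }
  where open TopologicalSpace X

-- The measurable sets of the subspace D are the traces B ∩ D with B
-- measurable in M.

subspace : ∀ {ℓ} (M : MeasurableSpace ℓ) → Pred (MeasurableSpace.Carrier M) ℓ → MeasurableSpace ℓ
subspace {ℓ} M D = record
  { setoid       = subsetoid setoid D
  ; Measurable   = Trace
  ; measurable-≐ = λ A≐A′ (B , mB , A≐B) → B , mB , ≐-trans (≐-sym A≐A′) A≐B
  ; measurable-⊤ = _ , measurable-⊤ , ≐-refl
  ; measurable-∁ = λ (B , mB , A⊆B , B⊆A) →
                     ∁ B , measurable-∁ mB ,
                     (λ x∉A x∈B → x∉A (B⊆A x∈B)) , (λ x∉B x∈A → x∉B (A⊆B x∈A))
  ; measurable-⋃ = λ mA →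
                     ⋃ ℕ (λ n → proj₁ (mA n)) , measurable-⋃ (λ n → proj₁ (proj₂ (mA n))) ,
                     (λ (n , x∈Aₙ) → n , proj₁ (proj₂ (proj₂ (mA n))) x∈Aₙ) ,
                     (λ (n , x∈Bₙ) → n , proj₂ (proj₂ (proj₂ (mA n))) x∈Bₙ)
  }
  where
  open MeasurableSpace M
  Trace : Pred (Pred (Σ Carrier D) ℓ) (suc ℓ)
  Trace A = ∃ λ B → Measurable B × A ≐ (proj₁ ⊢ B)

------------------------------------------------------------------------
-- Group actions

record GroupAction {c ℓ₁ a ℓ₂} (G : Group c ℓ₁) (S : Setoid a ℓ₂)
       : Set (c ⊔ ℓ₁ ⊔ a ⊔ ℓ₂) where
  open Setoid S
  private module G = Group G
  infixr 7 _·_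
  field
    _·_        : G.Carrier → Carrier → Carrier
    ·-cong     : ∀ {g h x y} → g G.≈ h → x ≈ y → g · x ≈ h · y
    ε-act      : ∀ x → G.ε · x ≈ x
    ∙-act      : ∀ g h x → (g G.∙ h) · x ≈ g · h · x

  Orbit : Carrier → Pred Carrier (c ⊔ ℓ₂)
  Orbit x y = ∃ λ g → y ≈ g · x

  translate : ∀ {p} → G.Carrier → Pred Carrier p → Pred Carrier (a ⊔ ℓ₂ ⊔ p)
  translate g A y = ∃ λ x → x ∈ A × y ≈ g · x

  Invariant : ∀ {p} → Pred Carrier p → Set (c ⊔ a ⊔ p)
  Invariant D = ∀ g {x} → x ∈ D → g · x ∈ D

  Aperiodic : Set (c ⊔ a ⊔ ℓ₂)
  Aperiodic = ∀ x → Infinite (subsetoid S (Orbit x))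

restrict : ∀ {c ℓ₁ a ℓ₂ p} {G : Group c ℓ₁} {S : Setoid a ℓ₂} (α : GroupAction G S)
           {D : Pred (Setoid.Carrier S) p} → GroupAction.Invariant α D →
           GroupAction G (subsetoid S D)
restrict α inv = record
  { _·_    = λ g (x , x∈D) → g · x , inv g x∈D
  ; ·-cong = ·-cong
  ; ε-act  = λ (x , _) → ε-act x
  ; ∙-act  = λ g h (x , _) → ∙-act g h x
  }
  where open GroupAction α

record PolishGSpace {ℓ} (G : Group ℓ ℓ) : Set (suc (suc ℓ)) where
  field
    space      : TopologicalSpace ℓ
    isPolish   : IsPolish space
    action     : GroupAction G (TopologicalSpace.setoid space)
    continuous : Continuous (discrete (Group.setoid G) ×ₜ space) space
                   (λ (g , x) → GroupAction._·_ action g x)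

  open TopologicalSpace space public using (setoid; Carrier; IsOpen)
  open GroupAction action public using (Orbit; Invariant; Aperiodic)

------------------------------------------------------------------------
-- Generators

module _ {ℓ} {G : Group ℓ ℓ} (M : MeasurableSpace ℓ)
         (α : GroupAction G (MeasurableSpace.setoid M)) where
  open MeasurableSpace M
  open GroupAction α

  Translates : ∀ {k} → (Fin k → Pred Carrier ℓ) → Pred (Pred Carrier ℓ) ℓ
  Translates A B = ∃₂ λ g n → B ≐ translate g (A n)

  record IsGenerator {k : ℕ} (A : Fin k → Pred Carrier ℓ) : Set (suc ℓ) where
    field
      measurable : ∀ n → Measurable (A n)
      disjoint   : ∀ {m n} → ¬ (m ≡ n) → A m ⊥ A n
      covering   : Universal (⋃ (Fin k) A)
      generates  : σ⟨ Translates A ⟩ ≐ Measurable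

  HasGenerator : ℕ → Set (suc ℓ)
  HasGenerator k = ∃ λ (A : Fin k → Pred Carrier ℓ) → IsGenerator A

module Submission where

-- Finite lists T of group elements act as averaging operators:
-- cnt T P z counts the t in T, with multiplicity, with t · z in P.  Lists
-- T 0, T 1, ... are built as successive products such that the multiset
-- T m · z has no heavy points near an infinite orbit, for large m; by the
-- product structure, a density bound at one m holds at all later ones.
-- Consequently finitely many translates of a small neighbourhood W of a
-- point have small density at every z, uniformly (translates-sparse).
--
-- A set A is built in stages.  Stage s moves a point of a given basic open
-- set by some g s to a region not yet decided, takes a small W s there, and
-- colours most of T (n s) · w for w in W s, leaving T (n j) · w uncoloured
-- where possible for j < s and freezing the surroundings.  Then s is the
-- least j for which at least half of T (n j) · w lies in A, so A alone
-- reveals s on W s.  As s ranges over the stages with a fixed index ν, the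
-- sets g s ⁻¹ W s have dense union; on the comeager set D of points whose
-- orbits lie in all of these unions, a second set B records at g s · x
-- whether x lies in the ν-th basic open set.  The four atoms of the
-- algebra generated by A and B form the generator.

open import Algebra.Bundles using (Group)
open import Algebra.Properties.CommutativeSemigroup using (interchange; x∙yz≈y∙xz)
open import Axiom.ExcludedMiddle using (ExcludedMiddle)
open import Data.Bool.Base using (Bool; true; false; if_then_else_)
open import Data.Empty using (⊥)
open import Data.Fin.Base using (Fin; zero; suc; remQuot; combine)
open import Data.Fin.Properties using (pigeonhole; remQuot-combine; combine-remQuot)
import Data.Fin.Properties as Fin
import Data.Integer.Base as ℤ
open import Data.List.Base using (List; []; _∷_; _++_; map; length; cartesianProductWith; applyUpTo; lookup)
open import Data.List.Membership.Propositional using (find; lose) renaming (_∈_ to _∈ˡ_)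
open import Data.List.Membership.Propositional.Properties
  using (∈-∃++; ∈-cartesianProductWith⁺; ∈-cartesianProductWith⁻; ∈-++⁺ˡ; ∈-++⁺ʳ; ∈-++⁻; ∈-map⁺; ∈-applyUpTo⁺; ∈-applyUpTo⁻)
open import Data.List.Properties using (length-++; length-map)
open import Data.List.Relation.Binary.Permutation.Propositional using (_↭_; prep; refl; swap; trans; ↭-refl; ↭-trans)
open import Data.List.Relation.Binary.Permutation.Propositional.Properties using (shift; ↭-length; ∈-resp-↭)
open import Data.List.Relation.Unary.All as All using (All; []; _∷_)
open import Data.List.Relation.Unary.AllPairs as AllPairs using (AllPairs; []; _∷_)
open import Data.List.Relation.Unary.Any as Any using (Any; here; there)
open import Data.List.Relation.Unary.Any.Properties using (lookup-index)
open import Data.Nat.Base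
open import Data.Nat.Properties
open import Data.Product.Base using (Σ; Σ-syntax; ∃; ∃₂; _×_; _,_; proj₁; proj₂)
open import Data.Rational.Base as ℚ using (ℚ; mkℚ; 0ℚ; ½)
import Data.Rational.Properties as ℚ
open import Data.Sum.Base as Sum using (_⊎_; inj₁; inj₂)
open import Data.Unit.Base using (⊤)
open import Function.Base using (_∘_; case_of_)
open import Function.Bundles using (Bijection; Injection; Equivalence)
open import Function.Metric.Structures using (IsGeneralMetric)
open import Level using (Level; Lift; lift; lower)
open import Relation.Binary.Bundles using (Setoid)
open import Relation.Binary.Definitions using (_Respects_; tri<; tri≈; tri>)
open import Relation.Binary.PropositionalEquality as ≡ using (_≡_; _≢_; refl; cong; cong₂; subst)
open import Relation.Nullary using (¬_; yes; no; does; contradiction)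
open import Relation.Unary using (Pred; _∈_; _⊆_; _∪_; _∩_; _⊢_; ∁; ⋃; _≐_; Satisfiable)
open import Relation.Unary.Properties using (≐-refl; ≐-sym; ≐-trans)
open import Defs

private variable
  ℓ₁ ℓ₂ ℓ₃ : Level
  I I′ : Set ℓ₁

-- Finite sums over lists, and splitting a list at chosen entries.

∑ : List I → (I → ℕ) → ℕ
∑ []       f = 0
∑ (x ∷ xs) f = f x + ∑ xs f

∑-++ : ∀ (xs ys : List I) f → ∑ (xs ++ ys) f ≡ ∑ xs f + ∑ ys f
∑-++ []       ys f = refl
∑-++ (x ∷ xs) ys f = ≡.trans (cong (f x +_) (∑-++ xs ys f)) (≡.sym (+-assoc (f x) _ _))

∑-map : ∀ (h : I → I′) xs f → ∑ (map h xs) f ≡ ∑ xs (f ∘ h)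
∑-map h []       f = refl
∑-map h (x ∷ xs) f = cong (f (h x) +_) (∑-map h xs f)

∑-↭ : ∀ {xs ys : List I} f → xs ↭ ys → ∑ xs f ≡ ∑ ys f
∑-↭ f refl          = refl
∑-↭ f (prep x p)    = cong (f x +_) (∑-↭ f p)
∑-↭ f (swap x y p)  = ≡.trans (≡.sym (+-assoc (f x) (f y) _))
                        (≡.trans (cong₂ _+_ (+-comm (f x) (f y)) (∑-↭ f p)) (+-assoc (f y) (f x) _))
∑-↭ f (trans p q)   = ≡.trans (∑-↭ f p) (∑-↭ f q)

∑-mono : ∀ (xs : List I) {f g : I → ℕ} → (∀ {x} → x ∈ˡ xs → f x ≤ g x) → ∑ xs f ≤ ∑ xs g
∑-mono []       f≤g = z≤n
∑-mono (x ∷ xs) f≤g = +-mono-≤ (f≤g (here refl)) (∑-mono xs (f≤g ∘ there))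

∑-+ : ∀ (xs : List I) f g → ∑ xs (λ x → f x + g x) ≡ ∑ xs f + ∑ xs g
∑-+ []       f g = refl
∑-+ (x ∷ xs) f g = ≡.trans (cong (f x + g x +_) (∑-+ xs f g)) (interchange +-commutativeSemigroup (f x) (g x) _ _)

∑-*ˡ : ∀ (xs : List I) k f → k * ∑ xs f ≡ ∑ xs (λ x → k * f x)
∑-*ˡ []       k f = *-zeroʳ k
∑-*ˡ (x ∷ xs) k f = ≡.trans (*-distribˡ-+ k (f x) _) (cong (k * f x +_) (∑-*ˡ xs k f))

∑-const : ∀ (xs : List I) k → ∑ xs (λ _ → k) ≡ length xs * k
∑-const []       k = refl
∑-const (x ∷ xs) k = cong (k +_) (∑-const xs k)

∑-bounded : ∀ (xs : List I) k {f} {m} → (∀ x → k * f x ≤ m) → k * ∑ xs f ≤ length xs * m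
∑-bounded xs k {f} {m} bound = begin
  k * ∑ xs f              ≡⟨ ∑-*ˡ xs k f ⟩
  ∑ xs (λ x → k * f x)    ≤⟨ ∑-mono xs (λ {x} _ → bound x) ⟩
  ∑ xs (λ _ → m)          ≡⟨ ∑-const xs m ⟩
  length xs * m           ∎
  where open ≤-Reasoning

length≡∑ : ∀ (xs : List I) → length xs ≡ ∑ xs (λ _ → 1)
length≡∑ xs = ≡.sym (≡.trans (∑-const xs 1) (*-identityʳ _))

∈-delete : ∀ {x e : I} ys {zs} → x ≢ e → x ∈ˡ (ys ++ e ∷ zs) → x ∈ˡ (ys ++ zs)
∈-delete {e = e} ys {zs} x≢e x∈ with ∈-resp-↭ (shift e ys zs) x∈
... | here x≡e  = contradiction x≡e x≢e
... | there x∈′ = x∈′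

-- Distinct elements occupy distinct positions, so they can be pulled to the front one after
-- another. This isolates chosen terms of a sum over a multiset.
extend-to-↭ : ∀ {es xs : List I} → AllPairs _≢_ es → All (_∈ˡ xs) es → ∃ λ rest → xs ↭ es ++ rest
extend-to-↭ {xs = xs} [] [] = xs , ↭-refl
extend-to-↭ {es = e ∷ es} (e#es ∷ ps) (e∈xs ∷ es⊆xs)
  with ys , zs , refl ← ∈-∃++ e∈xs
  with rest , p ← extend-to-↭ {xs = ys ++ zs} ps
         (All.tabulate λ x∈es → ∈-delete ys (All.lookup e#es x∈es ∘ ≡.sym) (All.lookup es⊆xs x∈es))
  = rest , ↭-trans (shift e ys zs) (prep e p)

-- Enumeration of pairs of natural numbers along diagonals.

diagonal-step : ℕ × ℕ → ℕ × ℕ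
diagonal-step (m , zero)  = 0 , suc m
diagonal-step (m , suc n) = suc m , n

unpair : ℕ → ℕ × ℕ
unpair zero    = 0 , 0
unpair (suc n) = diagonal-step (unpair n)

unpair-surjective : ∀ m n → ∃ λ k → unpair k ≡ (m , n)
unpair-surjective m n = along m n (from (m + n))
  where
  along : ∀ m n → (∃ λ k → unpair k ≡ (0 , m + n)) → ∃ λ k → unpair k ≡ (m , n)
  along zero    n h = h
  along (suc m) n h =
    let k , eq = along m (suc n) (subst (λ s → ∃ λ k → unpair k ≡ (0 , s)) (≡.sym (+-suc m n)) h)
    in suc k , cong diagonal-step eq
  -- The diagonal of sum `suc s` starts right after `(s , 0)`, the end of the one before.
  from : ∀ s → ∃ λ k → unpair k ≡ (0 , s)
  from zero    = 0 , refl
  from (suc s) =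
    let k , eq = along s 0 (subst (λ t → ∃ λ k → unpair k ≡ (0 , t)) (≡.sym (+-identityʳ s)) (from s))
    in suc k , cong diagonal-step eq

strict-bound : ∀ {k} (f : Fin k → ℕ) → ∃ λ m → ∀ i → f i < m
strict-bound {zero}  f = 0 , λ ()
strict-bound {suc k} f with m , f<m ← strict-bound (f ∘ suc) = suc (f zero) ⊔ m , λ where
  zero    → m≤m⊔n _ m
  (suc i) → ≤-trans (f<m i) (m≤n⊔m (suc (f zero)) m)

-- Classical logic and indicator functions.

module Classical (em : ∀ {a} → ExcludedMiddle a) where

  by-contradiction : {P : Set ℓ₁} → ¬ ¬ P → P
  by-contradiction {P = P} ¬¬p with em {P = P}
  ... | yes p = p
  ... | no ¬p = contradiction ¬p ¬¬p

  χ : Set ℓ₁ → ℕ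
  χ P = if does (em {P = P}) then 1 else 0

  χ-yes : {P : Set ℓ₁} → P → χ P ≡ 1
  χ-yes {P = P} p with em {P = P}
  ... | yes _ = refl
  ... | no ¬p = contradiction p ¬p

  χ-no : {P : Set ℓ₁} → ¬ P → χ P ≡ 0
  χ-no {P = P} ¬p with em {P = P}
  ... | yes p = contradiction p ¬p
  ... | no _  = refl

  χ≤1 : (P : Set ℓ₁) → χ P ≤ 1
  χ≤1 P with em {P = P}
  ... | yes _ = ≤-refl
  ... | no _  = z≤n

  χ-mono : {P : Set ℓ₁} {Q : Set ℓ₂} → (P → Q) → χ P ≤ χ Q
  χ-mono {P = P} {Q} f with em {P = P}
  ... | no _  = z≤n
  ... | yes p = ≤-reflexive (≡.sym (χ-yes (f p)))

  χ-⊎ : {P : Set ℓ₁} {Q : Set ℓ₂} → χ (P ⊎ Q) ≤ χ P + χ Q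
  χ-⊎ {P = P} {Q} with em {P = P ⊎ Q}
  ... | no _         = z≤n
  ... | yes (inj₁ p) = subst (λ k → 1 ≤ k + χ Q) (≡.sym (χ-yes p)) (s≤s z≤n)
  ... | yes (inj₂ q) = subst (λ k → 1 ≤ χ P + k) (≡.sym (χ-yes q)) (m≤n+m 1 (χ P))

  ∑χ≤1 : ∀ {es : List I} {P : I → Set ℓ₂} {R : I → I → Set ℓ₃} →
         AllPairs R es → (∀ {x y} → R x y → P x → ¬ P y) → ∑ es (χ ∘ P) ≤ 1
  ∑χ≤1 [] exclusive = z≤n
  ∑χ≤1 {es = e ∷ es} {P} (e#es ∷ ps) exclusive with em {P = P e}
  ... | no _  = ∑χ≤1 ps exclusive
  ... | yes p = ≤-reflexive (cong suc (none es e#es))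
    where
    none : ∀ xs → All _ xs → ∑ xs (χ ∘ P) ≡ 0
    none []       []       = refl
    none (x ∷ xs) (r ∷ rs) = cong₂ _+_ (χ-no (exclusive r p)) (none xs rs)

-- Averaging over finite lists of group elements.

module Counting (em : ∀ {a} → ExcludedMiddle a) {ℓ} (G : Group ℓ ℓ) (S : Setoid ℓ ℓ) (α : GroupAction G S) where

  open Classical em
  private module G = Group G
  open G using (_∙_; ε; _⁻¹) renaming (Carrier to Γ)
  open Setoid S using (Carrier; _≈_; reflexive) renaming (refl to ≈-refl; sym to ≈-sym; trans to ≈-trans)
  open GroupAction α

  ·-congˡ : ∀ {g x y} → x ≈ y → g · x ≈ g · y
  ·-congˡ = ·-cong G.refl

  ⁻¹-·-cancel : ∀ g x → g ⁻¹ · g · x ≈ x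
  ⁻¹-·-cancel g x = ≈-trans (≈-sym (∙-act _ _ _)) (≈-trans (·-cong (G.inverseˡ g) ≈-refl) (ε-act x))

  ·-⁻¹-cancel : ∀ g x → g · g ⁻¹ · x ≈ x
  ·-⁻¹-cancel g x = ≈-trans (≈-sym (∙-act _ _ _)) (≈-trans (·-cong (G.inverseʳ g) ≈-refl) (ε-act x))

  infixl 7 _⊙_

  -- Convolution of multisets: `E` acts first and multiplicities are kept. With `E` as the outer
  -- list, sums group by `e`.
  _⊙_ : List Γ → List Γ → List Γ
  T ⊙ E = cartesianProductWith (λ e t → t ∙ e) E T

  ∈-⊙⁺ : ∀ {T E t e} → t ∈ˡ T → e ∈ˡ E → (t ∙ e) ∈ˡ (T ⊙ E)
  ∈-⊙⁺ t∈T e∈E = ∈-cartesianProductWith⁺ _ e∈E t∈T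

  ∈-⊙⁻ : ∀ T E {g} → g ∈ˡ (T ⊙ E) → ∃₂ λ t e → t ∈ˡ T × e ∈ˡ E × g ≡ t ∙ e
  ∈-⊙⁻ T E g∈ = let e , t , e∈E , t∈T , eq = ∈-cartesianProductWith⁻ _ E T g∈ in t , e , t∈T , e∈E , eq

  ∑-⊙ : ∀ T E f → ∑ (T ⊙ E) f ≡ ∑ E (λ e → ∑ T (λ t → f (t ∙ e)))
  ∑-⊙ T []      f = refl
  ∑-⊙ T (e ∷ E) f = ≡.trans (∑-++ (map (_∙ e) T) (T ⊙ E) f) (cong₂ _+_ (∑-map (_∙ e) T f) (∑-⊙ T E f))

  length-⊙ : ∀ T E → length (T ⊙ E) ≡ length E * length T
  length-⊙ T []      = refl
  length-⊙ T (e ∷ E) = ≡.trans (length-++ (map (_∙ e) T)) (cong₂ _+_ (length-map _ T) (length-⊙ T E))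

  cnt : List Γ → Pred Carrier ℓ → Carrier → ℕ
  cnt T P z = ∑ T (λ t → χ (P (t · z)))

  cnt-mono : ∀ T {P Q y z} → (∀ {t} → t ∈ˡ T → P (t · y) → Q (t · z)) → cnt T P y ≤ cnt T Q z
  cnt-mono T P⇒Q = ∑-mono T (λ t∈T → χ-mono (P⇒Q t∈T))

  cnt≤length : ∀ T P z → cnt T P z ≤ length T
  cnt≤length T P z = ≤-trans (∑-mono T (λ _ → χ≤1 _)) (≤-reflexive (≡.sym (length≡∑ T)))

  cnt-∪ : ∀ T P Q z → cnt T (P ∪ Q) z ≤ cnt T P z + cnt T Q z
  cnt-∪ T P Q z = ≤-trans (∑-mono T (λ _ → χ-⊎)) (≤-reflexive (∑-+ T _ _))

  cnt-⊙ : ∀ T E {P} → P Respects _≈_ → ∀ z → cnt (T ⊙ E) P z ≤ ∑ E (λ e → cnt T P (e · z))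
  cnt-⊙ T E resp z = ≤-trans (≤-reflexive (∑-⊙ T E _))
    (∑-mono E (λ {e} _ → ∑-mono T (λ {t} _ → χ-mono (resp (∙-act t e z)))))

  cnt-none : ∀ T P z → (∀ {t} → t ∈ˡ T → ¬ P (t · z)) → cnt T P z ≡ 0
  cnt-none []      P z none = refl
  cnt-none (t ∷ T) P z none = cong₂ _+_ (χ-no (none (here refl))) (cnt-none T P z (none ∘ there))

  cnt-all : ∀ T P z → (∀ {t} → t ∈ˡ T → P (t · z)) → cnt T P z ≡ length T
  cnt-all []      P z all = refl
  cnt-all (t ∷ T) P z all = cong₂ _+_ (χ-yes (all (here refl))) (cnt-all T P z (all ∘ there))

  cnt-zero? : ∀ T P z → (∃ λ t → t ∈ˡ T × P (t · z)) ⊎ cnt T P z ≡ 0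
  cnt-zero? T P z with em {P = ∃ λ t → t ∈ˡ T × P (t · z)}
  ... | yes h = inj₁ h
  ... | no ¬h = inj₂ (cnt-none T P z (λ t∈T p → ¬h (_ , t∈T , p)))

  -- The density of `P` along `T ⊙ E` at `z` is the average over `e` in `E` of its densities along
  -- `T` at `e · z`, so a uniform bound survives.
  ⊙-bounded : ∀ T E {P} a c → P Respects _≈_ → (∀ z → a * cnt T P z ≤ c * length T) →
              ∀ z → a * cnt (T ⊙ E) P z ≤ c * length (T ⊙ E)
  ⊙-bounded T E {P} a c resp bound z = begin
    a * cnt (T ⊙ E) P z                  ≤⟨ *-monoʳ-≤ a (cnt-⊙ T E resp z) ⟩
    a * ∑ E (λ e → cnt T P (e · z))      ≤⟨ ∑-bounded E a (λ e → bound (e · z)) ⟩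
    length E * (c * length T)            ≡⟨ x∙yz≈y∙xz *-commutativeSemigroup (length E) c _ ⟩
    c * (length E * length T)            ≡⟨ cong (c *_) (length-⊙ T E) ⟨
    c * length (T ⊙ E)                   ∎
    where
    open ≤-Reasoning

  -- Averaging by lists with many separated elements.

  SeparatedAt : Carrier → Γ → Γ → Set ℓ
  SeparatedAt z g h = ¬ g · z ≈ h · z

  SeparatedAt⇒≢ : ∀ {z g h} → SeparatedAt z g h → g ≢ h
  SeparatedAt⇒≢ sep refl = sep ≈-refl

  -- A fixed `t` acts injectively, so it sends at most one of the distinct points `e · z` to `q`;
  -- each `t` thus contributes at most one.
  ∑-hits≤length : ∀ T q {z es} → AllPairs (SeparatedAt z) es →
                  ∑ es (λ e → cnt T (_≈ q) (e · z)) ≤ length T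
  ∑-hits≤length []      q {es = es} sep = ≤-reflexive (≡.trans (∑-const es 0) (*-zeroʳ (length es)))
  ∑-hits≤length (t ∷ T) q {z} {es} sep = ≤-trans (≤-reflexive (∑-+ es _ _))
    (+-mono-≤ (∑χ≤1 sep (λ g#h tgz≈q thz≈q → g#h (cancel (≈-trans tgz≈q (≈-sym thz≈q))))) (∑-hits≤length T q sep))
    where
    cancel : ∀ {x y} → t · x ≈ t · y → x ≈ y
    cancel eq = ≈-trans (≈-sym (⁻¹-·-cancel t _)) (≈-trans (·-congˡ eq) (⁻¹-·-cancel t _))

  Spread : ℕ → List Γ → Carrier → Set ℓ
  Spread k E z = ∃ λ es → length es ≡ k × AllPairs (SeparatedAt z) es × All (_∈ˡ E) es

  -- One averaging step: of the |E| summands of cnt (T ⊙ E), the k separated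
  -- ones contribute at most |T| in total.
  spread-step : ∀ T E q k r → (∀ v → length E * cnt T (_≈ q) v ≤ suc r * length T) →
                2 * length E ≤ k * suc r → ∀ z → Spread k E z →
                length E * cnt (T ⊙ E) (_≈ q) z ≤ r * length (T ⊙ E)
  spread-step T E q k r bound large z (es , refl , sep , es⊆E)
    with rest , E↭ ← extend-to-↭ (AllPairs.map SeparatedAt⇒≢ sep) es⊆E = begin
    l * cnt (T ⊙ E) (_≈ q) z                ≤⟨ *-monoʳ-≤ l (cnt-⊙ T E (λ x≈y x≈q → ≈-trans (≈-sym x≈y) x≈q) z) ⟩
    l * ∑ E f                               ≡⟨ cong (l *_) (≡.trans (∑-↭ f E↭) (∑-++ es rest f)) ⟩
    l * (∑ es f + ∑ rest f)                 ≡⟨ *-distribˡ-+ l (∑ es f) _ ⟩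
    l * ∑ es f + l * ∑ rest f               ≤⟨ +-mono-≤ (*-monoʳ-≤ l (∑-hits≤length T q sep)) (∑-bounded rest l (λ e → bound (e · z))) ⟩
    l * τ + length rest * (suc r * τ)       ≡⟨ cong (l * τ +_) (*-assoc (length rest) (suc r) τ) ⟨
    l * τ + length rest * suc r * τ         ≡⟨ *-distribʳ-+ τ l _ ⟨
    (l + length rest * suc r) * τ           ≤⟨ *-monoˡ-≤ τ few ⟩
    r * l * τ                               ≡⟨ *-assoc r l τ ⟩
    r * (l * τ)                             ≡⟨ cong (r *_) (length-⊙ T E) ⟨
    r * length (T ⊙ E)                      ∎
    where
    open ≤-Reasoning
    l = length E
    τ = length T
    f = λ e → cnt T (_≈ q) (e · z)
    few : l + length rest * suc r ≤ r * l
    few = +-cancelˡ-≤ l _ _ (begin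
      l + (l + length rest * suc r)                  ≡⟨ +-assoc l l _ ⟨
      l + l + length rest * suc r                    ≡⟨ cong (λ x → l + x + length rest * suc r) (+-identityʳ l) ⟨
      2 * l + length rest * suc r                    ≤⟨ +-monoˡ-≤ _ large ⟩
      length es * suc r + length rest * suc r        ≡⟨ *-distribʳ-+ (suc r) (length es) _ ⟨
      (length es + length rest) * suc r              ≡⟨ cong (_* suc r) (≡.trans (↭-length E↭) (length-++ es)) ⟨
      l * suc r                                      ≡⟨ *-comm l (suc r) ⟩
      l + r * l                                      ∎)

  iterate : List Γ → ℕ → List Γ → List Γ
  iterate E zero    T = T
  iterate E (suc j) T = iterate E j T ⊙ E

  iterate-bounded : ∀ T E {P} a c j → P Respects _≈_ → (∀ z → a * cnt T P z ≤ c * length T) →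
                    ∀ z → a * cnt (iterate E j T) P z ≤ c * length (iterate E j T)
  iterate-bounded T E a c zero    resp bound = bound
  iterate-bounded T E a c (suc j) resp bound =
    ⊙-bounded (iterate E j T) E a c resp (iterate-bounded T E a c j resp bound)

  -- The maximal frequency of q drops by 1 / |E| per step until it is at
  -- most 2 / k, so |E| steps suffice.
  iterate-spread : ∀ T E q k → .{{_ : NonZero (length E)}} →
    (∀ j z → (∃ λ t → t ∈ˡ iterate E j T × t · z ≈ q) → Spread k E z) →
    ∀ j r → j + r ≡ length E →
    (∀ z → length E * cnt (iterate E j T) (_≈ q) z ≤ r * length (iterate E j T)) ⊎
    (∀ z → k * cnt (iterate E j T) (_≈ q) z ≤ 2 * length (iterate E j T))
  iterate-spread T E q k spread zero    r refl = inj₁ λ z → *-monoʳ-≤ r (cnt≤length T (_≈ q) z)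
  iterate-spread T E q k spread (suc j) r j+r≡
    with iterate-spread T E q k spread j (suc r) (≡.trans (+-suc j r) j+r≡)
  ... | inj₂ bound = inj₂ (⊙-bounded (iterate E j T) E k 2 (λ x≈y x≈q → ≈-trans (≈-sym x≈y) x≈q) bound)
  ... | inj₁ bound with ≤-total (2 * length E) (k * suc r)
  ...   | inj₁ large = inj₁ λ z → case cnt-zero? (iterate E (suc j) T) (_≈ q) z of λ where
            (inj₁ h)  → spread-step (iterate E j T) E q k r bound large z (spread (suc j) z h)
            (inj₂ eq) → ≤-trans (≤-reflexive (≡.trans (cong (length E *_) eq) (*-zeroʳ (length E)))) z≤n
  ...   | inj₂ small = inj₂ (⊙-bounded T′ E k 2 (λ x≈y x≈q → ≈-trans (≈-sym x≈y) x≈q) λ z →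
            *-cancelˡ-≤ (length E) (begin
              l * (k * cnt T′ (_≈ q) z)     ≡⟨ *-assoc l k _ ⟨
              l * k * cnt T′ (_≈ q) z       ≡⟨ cong (_* cnt T′ (_≈ q) z) (*-comm l k) ⟩
              k * l * cnt T′ (_≈ q) z       ≡⟨ *-assoc k l _ ⟩
              k * (l * cnt T′ (_≈ q) z)     ≤⟨ *-monoʳ-≤ k (bound z) ⟩
              k * (suc r * length T′)       ≡⟨ *-assoc k (suc r) _ ⟨
              k * suc r * length T′         ≤⟨ *-monoˡ-≤ (length T′) small ⟩
              2 * l * length T′             ≡⟨ cong (_* length T′) (*-comm 2 l) ⟩
              l * 2 * length T′             ≡⟨ *-assoc l 2 _ ⟩
              l * (2 * length T′)           ∎))
    where
    open ≤-Reasoning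
    l = length E
    T′ = iterate E j T

  -- Words in finitely many elements and growth along an infinite orbit.

  -- Being in the monoid generated by `L`, expressed by the effect on points: closure under `L`
  -- passes to `T`. In this form membership can be carried along an orbit.
  GeneratedBy : List Γ → List Γ → Set _
  GeneratedBy L T = ∀ (J : Pred Carrier ℓ) → J Respects _≈_ →
    (∀ {l v} → l ∈ˡ L → J v → J (l · v)) → ∀ {t v} → t ∈ˡ T → J v → J (t · v)

  generated-⊙ : ∀ {L T E} → GeneratedBy L T → GeneratedBy L E → GeneratedBy L (T ⊙ E)
  generated-⊙ {T = T} {E} genT genE J resp closed te∈ v∈J
    with t , e , t∈T , e∈E , refl ← ∈-⊙⁻ T E te∈ =
    resp (≈-sym (∙-act t e _)) (genT J resp closed t∈T (genE J resp closed e∈E v∈J))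

  generated-iterate : ∀ {L T E} j → GeneratedBy L T → GeneratedBy L E → GeneratedBy L (iterate E j T)
  generated-iterate zero    genT genE = genT
  generated-iterate (suc j) genT genE = generated-⊙ (generated-iterate j genT genE) genE

  generated-ε : ∀ {L} → GeneratedBy L (ε ∷ [])
  generated-ε J resp closed (here refl) v∈J = resp (≈-sym (ε-act _)) v∈J

  words : List Γ → ℕ → List Γ
  words L zero    = ε ∷ []
  words L (suc j) = words L j ++ L ⊙ words L j

  words-mono : ∀ {L i j g} → i ≤′ j → g ∈ˡ words L i → g ∈ˡ words L j
  words-mono ≤′-refl       g∈ = g∈
  words-mono (≤′-step i≤j) g∈ = ∈-++⁺ˡ (words-mono i≤j g∈)

  generated-words : ∀ L j → GeneratedBy L (words L j)
  generated-words L zero    = generated-ε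
  generated-words L (suc j) J resp closed w∈ v∈J with ∈-++⁻ (words L j) w∈
  ... | inj₁ w∈′ = generated-words L j J resp closed w∈′ v∈J
  ... | inj₂ w∈′ = generated-⊙ (λ J resp closed → closed) (generated-words L j) J resp closed w∈′ v∈J

  -- The points w · z over words w of length at most j number at least
  -- j + 1, or else are closed under L; in the latter case they include
  -- q and hence the k points d i · q.
  words-spread : ∀ {L k q z} (d : Fin k → Γ) → (∀ {i j} → d i · q ≈ d j · q → i ≡ j) → (∀ i → d i ∈ˡ L) →
    (∀ (J : Pred Carrier ℓ) → J Respects _≈_ → (∀ {l v} → l ∈ˡ L → J v → J (l · v)) → J z → J q) →
    ∀ j → j < k → ∃ λ es → length es ≡ suc j × AllPairs (SeparatedAt z) es ×
                           All (_∈ˡ words L j) es × ∃ λ e → e ∈ˡ es × e · z ≈ z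
  words-spread d inj d∈L reach zero    _   = ε ∷ [] , refl , [] ∷ [] , here refl ∷ [] , ε , here refl , ε-act _
  words-spread {L} {k} {q} {z} d inj d∈L reach (suc j) j<k
    with es , len , sep , es⊆ , e₀ , e₀∈ , e₀z≈z ← words-spread d inj d∈L reach j (<-trans (n<1+n j) j<k)
    with em {P = ∃₂ λ l e → l ∈ˡ L × e ∈ˡ es × (∀ {e′} → e′ ∈ˡ es → SeparatedAt z (l ∙ e) e′)}
  ... | yes (l , e , l∈L , e∈es , new) =
        (l ∙ e) ∷ es , cong suc len , All.tabulate new ∷ sep ,
        ∈-++⁺ʳ (words L j) (∈-⊙⁺ l∈L (All.lookup es⊆ e∈es)) ∷ All.map ∈-++⁺ˡ es⊆ ,
        e₀ , there e₀∈ , e₀z≈z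
  ... | no ¬new = let i , i′ , i<i′ , same = clash in contradiction
        (inj (≈-trans (lookup-index (hit i)) (≈-trans
          (reflexive (cong (λ n → lookup es n · z) same)) (≈-sym (lookup-index (hit i′))))))
        (Fin.<⇒≢ i<i′)
    where
    J : Pred Carrier ℓ
    J v = Any (λ e → v ≈ e · z) es
    J-resp : J Respects _≈_
    J-resp x≈y = Any.map (≈-trans (≈-sym x≈y))
    closed : ∀ {l v} → l ∈ˡ L → J v → J (l · v)
    closed {l} l∈L v∈J = by-contradiction λ lv∉J → let e , e∈es , v≈ez = find v∈J in
      ¬new (l , e , l∈L , e∈es , λ e′∈es eq → lv∉J (lose e′∈es
        (≈-trans (·-congˡ v≈ez) (≈-trans (≈-sym (∙-act l e z)) eq))))
    hit : ∀ i → J (d i · q)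
    hit i = closed (d∈L i) (reach J J-resp closed (lose e₀∈ (≈-sym e₀z≈z)))
    clash = pigeonhole (subst (_< k) (≡.sym len) j<k) (Any.index ∘ hit)

  -- If every translate of `q` were among `k` given ones, the index of the matching one would be a
  -- bijection of the orbit with `Fin k`.
  separated-points : ∀ q → Infinite (subsetoid S (Orbit q)) → ∀ k →
                     ∃ λ (d : Fin k → Γ) → ∀ {i j} → d i · q ≈ d j · q → i ≡ j
  separated-points q inf zero    = (λ ()) , λ { {()} }
  separated-points q inf (suc k)
    with d , inj ← separated-points q inf k
    with em {P = ∃ λ g → ∀ i → SeparatedAt q g (d i)}
  ... | yes (g , new) = d′ , inj′
    where
    d′ : Fin (suc k) → Γ
    d′ zero    = g
    d′ (suc i) = d i
    inj′ : ∀ {i j} → d′ i · q ≈ d′ j · q → i ≡ j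
    inj′ {zero}  {zero}  eq = refl
    inj′ {zero}  {suc j} eq = contradiction eq (new j)
    inj′ {suc i} {zero}  eq = contradiction (≈-sym eq) (new i)
    inj′ {suc i} {suc j} eq = cong suc (inj eq)
  ... | no ¬new = contradiction finite inf
    where
    index : ∀ g → ∃ λ i → g · q ≈ d i · q
    index g = by-contradiction λ h → ¬new (g , λ i eq → h (i , eq))
    finite : Finite (subsetoid S (Orbit q))
    finite = k , record
      { to        = λ (_ , g , _) → proj₁ (index g)
      ; cong      = λ { {_ , g , x≈gq} {_ , h , y≈hq} x≈y → inj (≈-trans (≈-sym (proj₂ (index g)))
                      (≈-trans (≈-sym x≈gq) (≈-trans x≈y (≈-trans y≈hq (proj₂ (index h)))))) }
      ; bijective = (λ { {_ , g , x≈gq} {_ , h , y≈hq} eq → ≈-trans x≈gq (≈-trans (proj₂ (index g))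
                      (≈-trans (reflexive (cong (λ i → d i · q) eq)) (≈-sym (≈-trans y≈hq (proj₂ (index h)))))) })
                  , λ i → (d i · q , d i , ≈-refl) , λ { {_ , g , z≈gq} z≈dᵢq →
                      inj (≈-trans (≈-sym (proj₂ (index g))) (≈-trans (≈-sym z≈gq) z≈dᵢq)) }
      }

  length-words>0 : ∀ L j → 0 < length (words L j)
  length-words>0 L zero    = z<s
  length-words>0 L (suc j) = ≤-trans (length-words>0 L j)
    (≤-trans (m≤m+n _ _) (≤-reflexive (≡.sym (length-++ (words L j)))))

  length-iterate>0 : ∀ {T E} j → 0 < length T → 0 < length E → 0 < length (iterate E j T)
  length-iterate>0         zero    T>0 E>0 = T>0
  length-iterate>0 {T} {E} (suc j) T>0 E>0 =
    subst (0 <_) (≡.sym (length-⊙ (iterate E j T) E)) (*-mono-< E>0 (length-iterate>0 j T>0 E>0))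

  -- The lists `T m` and sets of small density along them.

  module Walk (γ : ℕ → Γ) (γ-surjective : ∀ g → ∃ λ n → γ n G.≈ g) where

    -- The word ball `E m` is applied `length (E m)` times because after that many steps the counter
    -- `r` of `iterate-spread` is zero.
    L E T : ℕ → List Γ
    L m = applyUpTo γ m
    E m = words (L m) m
    T zero    = ε ∷ []
    T (suc m) = iterate (E m) (length (E m)) (T m)

    T-nonempty : ∀ m → 0 < length (T m)
    T-nonempty zero    = z<s
    T-nonempty (suc m) = length-iterate>0 (length (E m)) (T-nonempty m) (length-words>0 (L m) m)

    generated-T : ∀ m → GeneratedBy (L m) (T m)
    generated-next : ∀ m j → GeneratedBy (L m) (iterate (E m) j (T m))
    generated-T zero    = generated-ε
    generated-T (suc m) J resp closed = generated-next m (length (E m)) J resp λ l∈L → closed (L-step l∈L)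
      where
      L-step : ∀ {l} → l ∈ˡ L m → l ∈ˡ L (suc m)
      L-step l∈L = let i , i<m , eq = ∈-applyUpTo⁻ γ l∈L in
        subst (_∈ˡ L (suc m)) (≡.sym eq) (∈-applyUpTo⁺ γ (m<n⇒m<1+n i<m))
    generated-next m j = generated-iterate j (generated-T m) (generated-words (L m) m)

    -- At every `z` the density of `P` along `T m` is at most `c / a`. As a record, it lets the
    -- parameters be inferred.
    record Sparse (a c : ℕ) (P : Pred Carrier ℓ) (m : ℕ) : Set ℓ where
      constructor sparse
      field bound : ∀ z → a * cnt (T m) P z ≤ c * length (T m)

    open Sparse public

    sparse-≤ : ∀ {a c P m n} → P Respects _≈_ → m ≤ n → Sparse a c P m → Sparse a c P n
    sparse-≤ {a} {c} {P} resp m≤n = go (≤⇒≤′ m≤n)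
      where
      go : ∀ {m n} → m ≤′ n → Sparse a c P m → Sparse a c P n
      go ≤′-refl           h = h
      go (≤′-step {n} m≤n) h = sparse (iterate-bounded (T n) (E n) a c (length (E n)) resp (bound (go m≤n h)))

    sparse-⊆ : ∀ {a c P Q m} → P ⊆ Q → Sparse a c Q m → Sparse a c P m
    sparse-⊆ {a} {c} {P} {Q} {m} P⊆Q h = sparse λ z →
      ≤-trans (*-monoʳ-≤ a (cnt-mono (T m) {P} {Q} {z} {z} (λ _ → P⊆Q))) (bound h z)

    sparse-none : ∀ {a c P} m → (∀ {v} → ¬ P v) → Sparse a c P m
    sparse-none {a} {c} {P} m none = sparse λ z → ≤-trans
      (≤-reflexive (≡.trans (cong (a *_) (cnt-none (T m) P z (λ _ → none))) (*-zeroʳ a))) z≤n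

    sparse-∪ : ∀ {a b c d P Q m} → Sparse a b P m → Sparse a c Q m → b + c ≤ d → Sparse a d (P ∪ Q) m
    sparse-∪ {a} {b} {c} {d} {P} {Q} {m} hP hQ b+c≤d = sparse λ z → begin
      a * cnt (T m) (P ∪ Q) z                     ≤⟨ *-monoʳ-≤ a (cnt-∪ (T m) P Q z) ⟩
      a * (cnt (T m) P z + cnt (T m) Q z)         ≡⟨ *-distribˡ-+ a (cnt (T m) P z) _ ⟩
      a * cnt (T m) P z + a * cnt (T m) Q z       ≤⟨ +-mono-≤ (bound hP z) (bound hQ z) ⟩
      b * length (T m) + c * length (T m)         ≡⟨ *-distribʳ-+ (length (T m)) b c ⟨
      (b + c) * length (T m)                      ≤⟨ *-monoˡ-≤ (length (T m)) b+c≤d ⟩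
      d * length (T m)                            ∎
      where open ≤-Reasoning

    sparse-*-cancelˡ : ∀ {a c P m} k → .{{_ : NonZero k}} → Sparse (k * a) (k * c) P m → Sparse a c P m
    sparse-*-cancelˡ {a} {c} {P} {m} k h = sparse λ z → *-cancelˡ-≤ k
      (≤-trans (≤-reflexive (≡.sym (*-assoc k a _))) (≤-trans (bound h z) (≤-reflexive (*-assoc k c _))))

    sparse-*ˡ : ∀ {a c P m} k → Sparse a c P m → Sparse (k * a) (k * c) P m
    sparse-*ˡ {a} {c} {P} {m} k h = sparse λ z →
      ≤-trans (≤-reflexive (*-assoc k a _)) (≤-trans (*-monoʳ-≤ k (bound h z)) (≤-reflexive (≡.sym (*-assoc k c _))))

    -- For `m` large, `L m` has elements taking `q` to `k` distinct points and `E m` contains all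
    -- words of length `N + N` in `L m`. Every `z` from which the walk can reach `q` then has `k`
    -- separated translates under `E m`, as `iterate-spread` requires.
    points-sparse : ∀ q → Infinite (subsetoid S (Orbit q)) → ∀ N → ∃ (Sparse N 1 (_≈ q))
    points-sparse q inf N = suc m , sparse few
      where
      -- The final bound `2 / k` requires `2 * N ≤ k`; words of length up to `N + N` yield one
      -- translate more, hence the successor.
      k = suc (N + N)
      d₀ = separated-points q inf k
      index : Fin k → ℕ
      index i = proj₁ (γ-surjective (proj₁ d₀ i))
      M = strict-bound index
      m = proj₁ M ⊔ k
      γ≈ : ∀ i → γ (index i) · q ≈ proj₁ d₀ i · q
      γ≈ i = ·-cong (proj₂ (γ-surjective (proj₁ d₀ i))) ≈-refl
      γ-inj : ∀ {i j} → γ (index i) · q ≈ γ (index j) · q → i ≡ j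
      γ-inj {i} {j} eq = proj₂ d₀ (≈-trans (≈-sym (γ≈ i)) (≈-trans eq (γ≈ j)))
      l = length (E m)
      instance
        l≢0 : NonZero l
        l≢0 = >-nonZero (length-words>0 (L m) m)
      spread : ∀ j z → (∃ λ t → t ∈ˡ iterate (E m) j (T m) × t · z ≈ q) → Spread k (E m) z
      spread j z (t , t∈ , tz≈q)
        with es , len , sep , es⊆ , _ ← words-spread {L m} {k} {q} {z} (γ ∘ index) γ-inj
               (λ i → ∈-applyUpTo⁺ γ (≤-trans (proj₂ M i) (m≤m⊔n (proj₁ M) k)))
               (λ J resp closed z∈J → resp tz≈q (generated-next m j J resp closed t∈ z∈J))
               (N + N) ≤-refl
        = es , len , sep , All.map (words-mono (≤⇒≤′ (≤-trans (n≤1+n _) (m≤n⊔m (proj₁ M) k)))) es⊆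
      few : ∀ z → N * cnt (T (suc m)) (_≈ q) z ≤ 1 * length (T (suc m))
      -- At `r = 0` the first alternative says that `q` is never hit; the second is the bound
      -- `2 / k`.
      few z with iterate-spread (T m) (E m) q k spread l 0 (+-identityʳ l)
      ... | inj₁ b = ≤-trans (≤-reflexive (≡.trans (cong (N *_)
              (n≤0⇒n≡0 (*-cancelˡ-≤ l (≤-trans (b z) (≤-reflexive (≡.sym (*-zeroʳ l))))))) (*-zeroʳ N))) z≤n
      ... | inj₂ b = *-cancelˡ-≤ 2 (begin
              2 * (N * f)                  ≡⟨ *-assoc 2 N f ⟨
              2 * N * f                    ≡⟨ cong (λ n → (N + n) * f) (+-identityʳ N) ⟩
              (N + N) * f                  ≤⟨ *-monoˡ-≤ f (n≤1+n (N + N)) ⟩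
              k * f                        ≤⟨ b z ⟩
              2 * length (T (suc m))       ≡⟨ cong (2 *_) (*-identityˡ (length (T (suc m)))) ⟨
              2 * (1 * length (T (suc m))) ∎)
        where
        open ≤-Reasoning
        f = cnt (T (suc m)) (_≈ q) z

-- Closure properties of measurable and Borel sets.

module Measurability (em : ∀ {a} → ExcludedMiddle a) {ℓ} (M : MeasurableSpace ℓ) where

  open Classical em
  open MeasurableSpace M

  measurable-∅ : Measurable (λ _ → Lift ℓ ⊥)
  measurable-∅ = measurable-≐ ((λ h → contradiction _ h) , λ ()) (measurable-∁ measurable-⊤)

  measurable-const : (P : Set ℓ) → Measurable (λ _ → P)
  measurable-const P with em {P = P}
  ... | yes p = measurable-≐ ((λ _ → p) , _) measurable-⊤
  ... | no ¬p = measurable-≐ ((λ ()) , λ p → contradiction p ¬p) measurable-∅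

  measurable-∪ : ∀ {A B} → Measurable A → Measurable B → Measurable (A ∪ B)
  measurable-∪ {A} {B} mA mB = measurable-≐ (to , from) (measurable-⋃ measurable)
    where
    family : ℕ → Pred Carrier ℓ
    family zero    = A
    family (suc _) = B
    measurable : ∀ n → Measurable (family n)
    measurable zero    = mA
    measurable (suc _) = mB
    to : ⋃ ℕ family ⊆ A ∪ B
    to (zero  , x∈A) = inj₁ x∈A
    to (suc _ , x∈B) = inj₂ x∈B
    from : A ∪ B ⊆ ⋃ ℕ family
    from (inj₁ x∈A) = 0 , x∈A
    from (inj₂ x∈B) = 1 , x∈B

  measurable-⋂ : ∀ {A : ℕ → Pred Carrier ℓ} → (∀ n → Measurable (A n)) → Measurable (λ x → ∀ n → A n x)
  measurable-⋂ mA = measurable-≐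
    ((λ x∉⋃ n → by-contradiction λ x∉A → x∉⋃ (n , x∉A)) , λ x∈⋂ (n , x∉A) → x∉A (x∈⋂ n))
    (measurable-∁ (measurable-⋃ λ n → measurable-∁ (mA n)))

  measurable-∩ : ∀ {A B} → Measurable A → Measurable B → Measurable (A ∩ B)
  measurable-∩ mA mB = measurable-≐
    ((λ h → by-contradiction (h ∘ inj₁) , by-contradiction (h ∘ inj₂)) ,
     λ { (x∈A , x∈B) (inj₁ x∉A) → x∉A x∈A ; (x∈A , x∈B) (inj₂ x∉B) → x∉B x∈B })
    (measurable-∁ (measurable-∪ (measurable-∁ mA) (measurable-∁ mB)))

borel-resp : ∀ {ℓ} (X : TopologicalSpace ℓ) (let open TopologicalSpace X) {A} →
             A ∈ σ⟨ IsOpen ⟩ → A Respects _≈_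
borel-resp X (generator oA)        = TopologicalSpace.open-resp X oA
borel-resp X (σ-≐ (A⊆B , B⊆A) mA) x≈y = A⊆B ∘ borel-resp X mA x≈y ∘ B⊆A
borel-resp X σ-⊤                   = _
borel-resp X (σ-∁ mA) x≈y x∉A      = x∉A ∘ borel-resp X mA (TopologicalSpace.sym X x≈y)
borel-resp X (σ-⋃ mA) x≈y (n , x∈A) = n , borel-resp X (mA n) x≈y x∈A

borel-preimage : ∀ {ℓ} (X Y : TopologicalSpace ℓ) {f} → Continuous X Y f →
                 ∀ {A} → A ∈ σ⟨ TopologicalSpace.IsOpen Y ⟩ → (f ⊢ A) ∈ σ⟨ TopologicalSpace.IsOpen X ⟩
borel-preimage X Y cont (generator oA)        = generator (cont oA)
borel-preimage X Y cont (σ-≐ (A⊆B , B⊆A) mA) = σ-≐ (A⊆B , B⊆A) (borel-preimage X Y cont mA)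
borel-preimage X Y cont σ-⊤                   = σ-⊤
borel-preimage X Y cont (σ-∁ mA)              = σ-∁ (borel-preimage X Y cont mA)
borel-preimage X Y cont (σ-⋃ mA)              = σ-⋃ (λ n → borel-preimage X Y cont (mA n))

-- Translates of small open sets.

module Construction (em : ∀ {a} → ExcludedMiddle a) {ℓ} (G : Group ℓ ℓ)
  (X : TopologicalSpace ℓ) (α : GroupAction G (TopologicalSpace.setoid X))
  (hausdorff : ∀ {x y} → ¬ TopologicalSpace._≈_ X x y → ∃₂ λ U V →
     TopologicalSpace.IsOpen X U × TopologicalSpace.IsOpen X V × x ∈ U × y ∈ V × (∀ {z} → z ∈ U → ¬ z ∈ V))
  (continuous : ∀ g {U} → TopologicalSpace.IsOpen X U → TopologicalSpace.IsOpen X (GroupAction._·_ α g ⊢ U))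
  (γ : ℕ → Group.Carrier G) (γ-surjective : ∀ g → ∃ λ n → Group._≈_ G (γ n) g)
  (aperiodic : GroupAction.Aperiodic α) where

  open Classical em
  private module G = Group G
  open G using (_∙_; ε; _⁻¹) renaming (Carrier to Γ)
  open TopologicalSpace X renaming (refl to ≈-refl; sym to ≈-sym; trans to ≈-trans)
  open GroupAction α
  open Counting em G setoid α
  open Walk γ γ-surjective

  open-∪ : ∀ {U V} → IsOpen U → IsOpen V → IsOpen (U ∪ V)
  open-∪ {U} {V} oU oV = open-≐ (to , from) (open-⋃ {I = Lift ℓ Bool} {U = family} opens)
    where
    family : Lift ℓ Bool → Pred Carrier ℓ
    family (lift b) = if b then U else V
    opens : ∀ i → IsOpen (family i)
    opens (lift true)  = oU
    opens (lift false) = oV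
    to : ⋃ (Lift ℓ Bool) family ⊆ U ∪ V
    to (lift true  , z∈U) = inj₁ z∈U
    to (lift false , z∈V) = inj₂ z∈V
    from : U ∪ V ⊆ ⋃ (Lift ℓ Bool) family
    from (inj₁ z∈U) = lift true  , z∈U
    from (inj₂ z∈V) = lift false , z∈V

  -- The union of the sets `h W` for `h` in `H`; writing `h W` as a preimage under `h ⁻¹` makes
  -- openness a case of continuity.
  _⟪_⟫ : List Γ → Pred Carrier ℓ → Pred Carrier ℓ
  H ⟪ W ⟫ = ⋃ (Σ Γ (_∈ˡ H)) λ (h , _) z → W (h ⁻¹ · z)

  ⟪⟫-open : ∀ H {W} → IsOpen W → IsOpen (H ⟪ W ⟫)
  ⟪⟫-open H oW = open-⋃ λ (h , _) → continuous (h ⁻¹) oW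

  ⟪⟫-mono : ∀ H {V W} → V ⊆ W → H ⟪ V ⟫ ⊆ H ⟪ W ⟫
  ⟪⟫-mono H V⊆W (h , z∈hV) = h , V⊆W z∈hV

  ⟪⟫-⁺ : ∀ {H h W w} → IsOpen W → h ∈ˡ H → W w → (H ⟪ W ⟫) (h · w)
  ⟪⟫-⁺ {h = h} oW h∈H w∈W = (h , h∈H) , open-resp oW (≈-sym (⁻¹-·-cancel h _)) w∈W

  -- Each `u` that moves `y` is handled by disjoint open sets around `y` and `u · y`: a point of the
  -- first that `u` sends into the second does not return to the first.
  separate : ∀ y (F : List Γ) → ∃ λ W → IsOpen W × W y × (∀ {u w} → u ∈ˡ F → W w → W (u · w) → u · y ≈ y)
  separate y []      = _ , open-⊤ , _ , λ ()
  separate y (u ∷ F) with W , oW , y∈W , sep ← separate y F | em {P = u · y ≈ y}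
  ... | yes uy≈y = W , oW , y∈W , λ { (here refl) _ _ → uy≈y ; (there u∈F) → sep u∈F }
  ... | no  uy≉y with U , V , oU , oV , y∈U , uy∈V , disj ← hausdorff (uy≉y ∘ ≈-sym) =
        W ∩ (U ∩ (u ·_) ⊢ V) , open-∩ oW (open-∩ oU (continuous u oV)) , (y∈W , y∈U , uy∈V) , λ where
          (here refl)  (_ , _ , uw∈V) (_ , uw∈U , _) → contradiction uw∈V (disj uw∈U)
          (there u∈F) (w∈W , _) (uw∈W , _) → sep u∈F w∈W uw∈W

  -- If t and t₀ both move z into h · W, then h⁻¹ t t₀⁻¹ h moves a point of W
  -- into W, hence fixes y; so only the returns to h · y need counting.
  translate-sparse : ∀ y h N → ∃₂ λ m W → IsOpen W × W y × Sparse N 1 (λ z → W (h ⁻¹ · z)) m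
  translate-sparse y h N
    with m , sp ← points-sparse (h · y) (aperiodic (h · y)) N
    with W , oW , y∈W , sep ← separate y (cartesianProductWith (λ t t₀ → h ⁻¹ ∙ (t ∙ (t₀ ⁻¹ ∙ h))) (T m) (T m))
    = m , W , oW , y∈W , sparse few
    where
    conj-act : ∀ t t₀ x → (h ⁻¹ ∙ (t ∙ (t₀ ⁻¹ ∙ h))) · x ≈ h ⁻¹ · t · t₀ ⁻¹ · h · x
    conj-act t t₀ x = ≈-trans (∙-act _ _ _) (·-congˡ (≈-trans (∙-act _ _ _) (·-congˡ (∙-act _ _ _))))
    few : ∀ z → N * cnt (T m) (λ z → W (h ⁻¹ · z)) z ≤ 1 * length (T m)
    few z with cnt-zero? (T m) (λ z → W (h ⁻¹ · z)) z
    ... | inj₂ eq = ≤-trans (≤-reflexive (≡.trans (cong (N *_) eq) (*-zeroʳ N))) z≤n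
    ... | inj₁ (t₀ , t₀∈T , w∈W) = ≤-trans
            (*-monoʳ-≤ N (cnt-mono (T m) {λ z → W (h ⁻¹ · z)} {_≈ h · y} {z} {t₀ ⁻¹ · h · y} same))
            (bound sp (t₀ ⁻¹ · h · y))
      where
      same : ∀ {t} → t ∈ˡ T m → W (h ⁻¹ · t · z) → t · t₀ ⁻¹ · h · y ≈ h · y
      same {t} t∈T tz∈ = ≈-trans (≈-sym (·-⁻¹-cancel h _)) (·-congˡ (≈-trans (≈-sym (conj-act t t₀ y))
        (sep (∈-cartesianProductWith⁺ _ t∈T t₀∈T) w∈W (open-resp oW (≈-sym (≈-trans (conj-act t t₀ _)
          (·-congˡ (·-congˡ (≈-trans (·-congˡ (·-⁻¹-cancel h _)) (⁻¹-·-cancel t₀ z)))))) tz∈))))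

  -- Induction on `H` with the tolerance halved: one half for the first translate and one for the
  -- rest, on the intersection of the neighbourhoods and at the later of the two times.
  translates-sparse : ∀ y H N → ∃₂ λ m W → IsOpen W × W y × Sparse N 1 (H ⟪ W ⟫) m
  translates-sparse y []      N = 0 , _ , open-⊤ , _ , sparse-none 0 λ { ((_ , ()) , _) }
  translates-sparse y (h ∷ H) N
    with m₁ , W₁ , oW₁ , y∈W₁ , sp₁ ← translate-sparse y h (2 * N)
       | m₂ , W₂ , oW₂ , y∈W₂ , sp₂ ← translates-sparse y H (2 * N)
    = m₁ ⊔ m₂ , W₁ ∩ W₂ , open-∩ oW₁ oW₂ , (y∈W₁ , y∈W₂) ,
      sparse-⊆ split (sparse-*-cancelˡ 2 (sparse-∪
        (sparse-≤ (open-resp (continuous (h ⁻¹) oW₁)) (m≤m⊔n m₁ m₂) sp₁)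
        (sparse-≤ (open-resp (⟪⟫-open H oW₂)) (m≤n⊔m m₁ m₂) sp₂) ≤-refl))
    where
    split : (h ∷ H) ⟪ W₁ ∩ W₂ ⟫ ⊆ ((λ z → W₁ (h ⁻¹ · z)) ∪ H ⟪ W₂ ⟫)
    split ((_ , here refl) , z∈W₁ , _) = inj₁ z∈W₁
    split ((k , there k∈H) , _ , z∈W₂) = inj₂ ((k , k∈H) , z∈W₂)

  -- A single stage of the construction.

  -- Each `t` is settled in turn: if it sends some point of `V` into the open set `O`, the part of
  -- `V` sent there replaces `V`; otherwise it sends all of `V` outside.
  shrink : ∀ (F : List Γ) {O U} → IsOpen O → IsOpen U → Satisfiable U →
           ∃ λ V → IsOpen V × V ⊆ U × Satisfiable V ×
           (∀ {t} → t ∈ˡ F → (∀ {v} → V v → O (t · v)) ⊎ (∀ {v} → V v → ¬ O (t · v)))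
  shrink []      {U = U} oO oU x∈U = U , oU , (λ z → z) , x∈U , λ ()
  shrink (t ∷ F) {O} {U} oO oU x∈U
    with V , oV , V⊆U , x∈V , decided ← shrink F oO oU x∈U
    with em {P = ∃ λ v → V v × O (t · v)}
  ... | no ¬h = V , oV , V⊆U , x∈V , λ where
          (here refl) → inj₂ λ v∈V tv∈O → ¬h (_ , v∈V , tv∈O)
          (there t∈F) → decided t∈F
  ... | yes (v , v∈) = V ∩ (t ·_) ⊢ O , open-∩ oV (continuous t oO) , V⊆U ∘ proj₁ , (v , v∈) , λ where
          (here refl) → inj₁ proj₂
          (there t∈F) → Sum.map (λ inside {_} z → inside (proj₁ z)) (λ outside {_} z → outside (proj₁ z)) (decided t∈F)

  -- Freezing K W keeps later stages from colouring around W; freezing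
  -- K⁻¹ T W keeps later choices of W away from the points just coloured.
  buffer : List Γ → ℕ → List Γ
  buffer K n = K ++ (map _⁻¹ K ⊙ T n)

  -- The region O has already been decided; it takes up less than a quarter
  -- of the multiset T m · z, for every z.
  record State : Set (Level.suc ℓ) where
    field
      O        : Pred Carrier ℓ
      O-open   : IsOpen O
      K        : List Γ
      m p      : ℕ
      sparse-O : Sparse (4 * suc p) p O m

  -- The two quarter bounds leave at least half of `T n · w` to be coloured for `w` in `W`. `hits`
  -- is conditional because `U` may be empty.
  record Step (s : State) (U : Pred Carrier ℓ) : Set (Level.suc ℓ) where
    open State s
    field
      W          : Pred Carrier ℓ
      W-open     : IsOpen W
      g          : Γ
      hits       : Satisfiable U → ∃ λ x → x ∈ U × W (g · x)
      avoids     : ∀ {w} → W w → ¬ O w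
      n          : ℕ
      few-old    : Sparse 4 1 O n
      few-frozen : Sparse 4 1 (K ⟪ W ⟫) n

      m⁺         : ℕ
      sparse-O⁺  : Sparse (4 * suc (suc (p + p))) (suc (p + p)) (O ∪ buffer (K ++ T n) n ⟪ W ⟫) m⁺

    next : State
    next = record
      { O        = O ∪ buffer (K ++ T n) n ⟪ W ⟫
      ; O-open   = open-∪ O-open (⟪⟫-open (buffer (K ++ T n) n) W-open)
      ; K        = K ++ T n
      ; m        = m⁺
      ; p        = suc (p + p)
      ; sparse-O = sparse-O⁺
      }

  initial : State
  initial = record
    { O        = λ _ → Lift ℓ ⊥
    ; O-open   = open-≐ ((λ ()) , λ ()) (open-⋃ {I = Lift ℓ ⊥} {U = λ ()} λ ())
    ; K        = []
    ; m        = 0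
    ; p        = 0
    ; sparse-O = sparse-none 0 λ ()
    }

  module _ (s : State) where
    open State s

    O-resp : O Respects _≈_
    O-resp = open-resp O-open

    sparse-quarter : ∀ {n} → m ≤ n → Sparse 4 1 O n
    sparse-quarter {n} m≤n = sparse-*-cancelˡ (suc p) (sparse λ z → begin
      suc p * 4 * cnt (T n) O z      ≡⟨ cong (_* cnt (T n) O z) (*-comm (suc p) 4) ⟩
      4 * suc p * cnt (T n) O z      ≤⟨ bound (sparse-≤ O-resp m≤n sparse-O) z ⟩
      p * length (T n)               ≤⟨ *-monoˡ-≤ (length (T n)) (≤-trans (n≤1+n p) (≤-reflexive (≡.sym (*-identityʳ (suc p))))) ⟩
      suc p * 1 * length (T n)       ∎)
      where open ≤-Reasoning

    -- As `p + 1` doubles from 1, the bound `p / (4 (p + 1))` runs through the partial sums of 1/8 +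
    -- 1/16 + ..., which stay below 1/4. The density `1 / (8 (p + 1))` allowed to `P` is the next
    -- term.
    refine-sparse : ∀ {P n} → m ≤ n → Sparse (2 * (4 * suc p)) 1 P n →
                    Sparse (4 * suc (suc (p + p))) (suc (p + p)) (O ∪ P) n
    refine-sparse {P} {n} m≤n sp = subst (λ a → Sparse a (suc (p + p)) (O ∪ P) n) double
      (sparse-∪ (sparse-*ˡ 2 (sparse-≤ O-resp m≤n sparse-O)) sp
        (≤-reflexive (≡.trans (+-comm (p + (p + 0)) 1) (cong (λ k → suc (p + k)) (+-identityʳ p)))))
      where
      double : 2 * (4 * suc p) ≡ 4 * suc (suc (p + p))
      double = ≡.trans (≡.sym (*-assoc 2 4 (suc p))) (≡.trans (*-assoc 4 2 (suc p))
        (cong (4 *_) (cong suc (≡.trans (+-suc p (p + 0)) (cong (λ k → suc (p + k)) (+-identityʳ p))))))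

    -- Otherwise `O` would have density 1 along the nonempty `T m` at `z`, above the bound
    -- `p / (4 (p + 1))`.
    undecided : ∀ z → ∃ λ t → t ∈ˡ T m × ¬ O (t · z)
    undecided z = by-contradiction λ h → <-irrefl refl (begin-strict
      p * length (T m)               <⟨ *-monoˡ-< (length (T m)) {{>-nonZero (T-nonempty m)}} (m≤n*m (suc p) 4) ⟩
      4 * suc p * length (T m)       ≡⟨ cong (4 * suc p *_) (cnt-all (T m) O z λ t∈T → by-contradiction λ tz∉O → h (_ , t∈T , tz∉O)) ⟨
      4 * suc p * cnt (T m) O z      ≤⟨ bound sparse-O z ⟩
      p * length (T m)               ∎)
      where open ≤-Reasoning

    step : ∀ U → IsOpen U → Step s U
    step U oU with em {P = Satisfiable U}
    -- For empty `U` the stage takes `W` empty and adds no point to the decided region, while `p`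
    -- still advances.
    ... | no ∄x = record
      { W = λ _ → Lift ℓ ⊥ ; W-open = State.O-open initial ; g = ε
      ; hits = λ x → contradiction x ∄x ; avoids = λ ()
      ; n = m ; few-old = sparse-quarter ≤-refl ; few-frozen = sparse-none m λ ()
      ; m⁺ = m ; sparse-O⁺ = refine-sparse ≤-refl (sparse-none m λ ())
      }
    ... | yes x∈U
      -- Each `t` in `T m` sends `V` entirely into or entirely outside `O`, so the `g` that takes
      -- `x` out of `O` takes all of `V` out.
      with V , oV , V⊆U , (x , x∈V) , decided ← shrink (T m) O-open oU x∈U
      with g , g∈T , gx∉O ← undecided x
      -- `W₁` fixes the time `m ⊔ n₁` at which its translates by `K` are rare. Only then is the
      -- buffer known, and `W₂` makes its translates sparse enough for the new bound.
      with n₁ , W₁ , oW₁ , y∈W₁ , sp₁ ← translates-sparse (g · x) K 4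
      with m₂ , W₂ , oW₂ , y∈W₂ , sp₂ ← translates-sparse (g · x) (buffer (K ++ T (m ⊔ n₁)) (m ⊔ n₁)) (2 * (4 * suc p))
      = record
      { W = W ; W-open = oW ; g = g
      ; hits = λ _ → x , V⊆U x∈V , open-resp oV (≈-sym (⁻¹-·-cancel g x)) x∈V , y∈W₁ , y∈W₂
      ; avoids = λ (v∈V , _) w∈O → avoid v∈V (O-resp (≈-sym (·-⁻¹-cancel g _)) w∈O)
      ; n = m ⊔ n₁
      ; few-old = sparse-quarter (m≤m⊔n m n₁)
      ; few-frozen = sparse-≤ (open-resp (⟪⟫-open K oW)) (m≤n⊔m m n₁) (sparse-⊆ (⟪⟫-mono K {W} {W₁} (proj₁ ∘ proj₂)) sp₁)
      ; m⁺ = m ⊔ m₂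
      ; sparse-O⁺ = refine-sparse (m≤m⊔n m m₂)
          (sparse-≤ (open-resp (⟪⟫-open _ oW)) (m≤n⊔m m m₂) (sparse-⊆ (⟪⟫-mono (buffer (K ++ T (m ⊔ n₁)) (m ⊔ n₁)) {W} {W₂} (proj₂ ∘ proj₂)) sp₂))
      }
      where
      W : Pred Carrier ℓ
      W = (g ⁻¹ ·_) ⊢ V ∩ (W₁ ∩ W₂)
      oW : IsOpen W
      oW = open-∩ (continuous (g ⁻¹) oV) (open-∩ oW₁ oW₂)
      avoid : ∀ {v} → V v → ¬ O (g · v)
      avoid v∈V with decided g∈T
      ... | inj₁ inside  = contradiction (inside x∈V) gx∉O
      ... | inj₂ outside = outside v∈V

  -- The set `A` and the recognition of stages from it.

  -- A recursive form of `k ≤ cnt T A z`, from which measurability follows by finitely many unions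
  -- and intersections.
  AtLeast : ℕ → List Γ → Pred Carrier ℓ → Pred Carrier ℓ
  AtLeast zero    T       A z = Lift ℓ ⊤
  AtLeast (suc k) []      A z = Lift ℓ ⊥
  AtLeast (suc k) (t ∷ T) A z = (A (t · z) × AtLeast k T A z) ⊎ AtLeast (suc k) T A z

  atLeast⇒≤cnt : ∀ k T {A z} → AtLeast k T A z → k ≤ cnt T A z
  atLeast⇒≤cnt zero    T       h              = z≤n
  atLeast⇒≤cnt (suc k) (t ∷ T) {A} {z} (inj₁ (a , h)) =
    subst (λ c → suc k ≤ c + cnt T A z) (≡.sym (χ-yes a)) (s≤s (atLeast⇒≤cnt k T h))
  atLeast⇒≤cnt (suc k) (t ∷ T) (inj₂ h)       = ≤-trans (atLeast⇒≤cnt (suc k) T h) (m≤n+m _ _)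

  ≤cnt⇒atLeast : ∀ k T {A z} → k ≤ cnt T A z → AtLeast k T A z
  ≤cnt⇒atLeast zero    T       h = _
  ≤cnt⇒atLeast (suc k) (t ∷ T) {A} {z} h with em {P = A (t · z)}
  ... | yes a = inj₁ (a , ≤cnt⇒atLeast k T (s≤s⁻¹ h))
  ... | no ¬a = inj₂ (≤cnt⇒atLeast (suc k) T h)

  module Stages (base : ℕ → Pred Carrier ℓ) (base-open : ∀ i → IsOpen (base i)) where

    -- Stage `s` places its signal for points of `base (target s)` and encodes membership in
    -- `base (index s)`. Every pair occurs, so each index is served inside each basic set.
    target index : ℕ → ℕ
    target s = proj₁ (unpair s)
    index  s = proj₂ (unpair s)

    state : ℕ → State
    stage : ∀ s → Step (state s) (base (target s))
    state zero    = initial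
    state (suc s) = Step.next (stage s)
    stage s = step (state s) (base (target s)) (base-open (target s))

    module State′ (s : ℕ) = State (state s)
    module Step′ (s : ℕ) = Step (stage s)
    open State′ using (O; O-open; K)
    open Step′ using (W; W-open; g; hits; avoids; n; few-old; few-frozen)

    -- `K s` contains `T (n j)` for all `j < s`, so removing `K s ⟪ W s ⟫` keeps stage `s` from
    -- colouring the points that test for earlier stages on `W s`.
    coloured : ℕ → Pred Carrier ℓ
    coloured s = T (n s) ⟪ W s ⟫ ∩ ∁ (O s ∪ K s ⟪ W s ⟫)

    A : Pred Carrier ℓ
    A = ⋃ ℕ coloured

    O-mono : ∀ {i j} → i ≤ j → O i ⊆ O j
    O-mono i≤j = go (≤⇒≤′ i≤j)
      where
      go : ∀ {i j} → i ≤′ j → O i ⊆ O j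
      go ≤′-refl       z∈O = z∈O
      go (≤′-step i≤j) z∈O = inj₁ (go i≤j z∈O)

    T⊆K : ∀ {j s t} → j < s → t ∈ˡ T (n j) → t ∈ˡ K s
    T⊆K j<s = go (≤⇒≤′ j<s)
      where
      go : ∀ {j s t} → j <′ s → t ∈ˡ T (n j) → t ∈ˡ K s
      go {j} <′-base        t∈T = ∈-++⁺ʳ (K j) t∈T
      go     (<′-step j<s) t∈T = ∈-++⁺ˡ (go j<s t∈T)

    frozen⊆O : ∀ s {t w} → t ∈ˡ K (suc s) → W s w → O (suc s) (t · w)
    frozen⊆O s t∈K w∈W = inj₂ (⟪⟫-⁺ (W-open s) (∈-++⁺ˡ t∈K) w∈W)

    coloured⊆O : ∀ s → coloured s ⊆ O (suc s)
    coloured⊆O s (((t , t∈T) , z∈tW) , _) = inj₂ ((t , ∈-++⁺ˡ (∈-++⁺ʳ (K s) t∈T)) , z∈tW)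

    -- If `t · w` is `r · v` with `v` in `W s`, then `w` is `(t ⁻¹ ∙ r) · v`, which the second part
    -- of the buffer covers.
    near-coloured⊆O : ∀ s {t w} → t ∈ˡ K (suc s) → coloured s (t · w) → O (suc s) w
    near-coloured⊆O s {t} {w} t∈K (((r , r∈T) , v∈W) , _) = inj₂
      ((t ⁻¹ ∙ r , ∈-++⁺ʳ (K (suc s)) (∈-⊙⁺ (∈-map⁺ _⁻¹ t∈K) r∈T)) , open-resp (W-open s) (≈-sym eq) v∈W)
      where
      eq : (t ⁻¹ ∙ r) ⁻¹ · w ≈ r ⁻¹ · t · w
      eq = ≈-trans (·-congˡ (≈-sym (≈-trans (∙-act _ _ _)
        (≈-trans (·-congˡ (·-⁻¹-cancel r _)) (⁻¹-·-cancel t w))))) (⁻¹-·-cancel (t ⁻¹ ∙ r) _)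

    -- The colour of `t · w` is not from stage `s`, which spares `K s ⟪ W s ⟫`; nor from a later
    -- one, as `t · w` is frozen; nor from a stage `i` with `j ≤ i < s`, as `w` would then lie in
    -- `O s`, which `W s` avoids. Stages before `j` colour only inside `O j`.
    coloured-nearby : ∀ {j s t w} → j < s → W s w → t ∈ˡ T (n j) → A (t · w) → O j (t · w)
    coloured-nearby {j} {s} {t} {w} j<s w∈W t∈T (i , tw∈) with <-cmp i s
    ... | tri≈ _ refl _ = contradiction (inj₂ (⟪⟫-⁺ (W-open s) (T⊆K j<s t∈T) w∈W)) (proj₂ tw∈)
    ... | tri> _ _ s<i = contradiction
            (inj₁ (O-mono s<i (frozen⊆O s (∈-++⁺ˡ (T⊆K j<s t∈T)) w∈W))) (proj₂ tw∈)
    ... | tri< i<s _ _ with <-≤-connex i j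
    ...   | inj₁ i<j = O-mono i<j (coloured⊆O i tw∈)
    ...   | inj₂ j≤i = contradiction
              (O-mono i<s (near-coloured⊆O i (T⊆K (s≤s j≤i) t∈T) tw∈)) (avoids s w∈W)

    Marked : ℕ → Pred Carrier ℓ
    Marked s = AtLeast ⌈ length (T (n s)) /2⌉ (T (n s)) A

    -- The points of `T (n s) · w` that stage `s` spares lie in `O s` or `K s ⟪ W s ⟫`, each at most
    -- a quarter of the whole.
    W⊆marked : ∀ s → W s ⊆ Marked s
    W⊆marked s {w} w∈W = ≤cnt⇒atLeast _ (T (n s)) (begin
      ⌈ l /2⌉          ≤⟨ ⌈n/2⌉-mono half ⟩
      ⌈ a + a /2⌉      ≡⟨ n≡⌈n+n/2⌉ a ⟨
      a                ∎)
      where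
      open ≤-Reasoning
      l = length (T (n s))
      B = K s ⟪ W s ⟫
      a = cnt (T (n s)) A w
      o = cnt (T (n s)) (O s) w
      b = cnt (T (n s)) B w
      split : ∀ {t} → t ∈ˡ T (n s) → (A ∪ (O s ∪ B)) (t · w)
      split {t} t∈T with em {P = (O s ∪ B) (t · w)}
      ... | yes old = inj₂ old
      ... | no ¬old = inj₁ (s , ⟪⟫-⁺ (W-open s) t∈T w∈W , ¬old)
      total : l ≤ a + (o + b)
      total = begin
        l                                          ≡⟨ cnt-all (T (n s)) (A ∪ (O s ∪ B)) w split ⟨
        cnt (T (n s)) (A ∪ (O s ∪ B)) w            ≤⟨ cnt-∪ (T (n s)) A (O s ∪ B) w ⟩
        a + cnt (T (n s)) (O s ∪ B) w              ≤⟨ +-monoʳ-≤ a (cnt-∪ (T (n s)) (O s) B w) ⟩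
        a + (o + b)                                ∎
      half : l ≤ a + a
      half = *-cancelˡ-≤ 2 (+-cancelʳ-≤ (l + l) _ _ (begin
        2 * l + (l + l)                   ≡⟨ cong (λ k → 2 * l + (l + k)) (+-identityʳ l) ⟨
        2 * l + 2 * l                     ≡⟨ *-distribʳ-+ l 2 2 ⟨
        4 * l                             ≤⟨ *-monoʳ-≤ 4 total ⟩
        4 * (a + (o + b))                 ≡⟨ *-distribˡ-+ 4 a (o + b) ⟩
        4 * a + 4 * (o + b)               ≡⟨ cong (4 * a +_) (*-distribˡ-+ 4 o b) ⟩
        4 * a + (4 * o + 4 * b)           ≤⟨ +-monoʳ-≤ (4 * a) (+-mono-≤ (bound (few-old s) w) (bound (few-frozen s) w)) ⟩
        4 * a + (1 * l + 1 * l)           ≡⟨ cong₂ _+_ (≡.trans (*-assoc 2 2 a) (cong (λ k → 2 * (a + k)) (+-identityʳ a))) (cong₂ _+_ (*-identityˡ l) (*-identityˡ l)) ⟩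
        2 * (a + a) + (l + l)             ∎))

    -- By `coloured-nearby` the coloured part of `T (n j) · w` lies in `O j`, so it is at most a
    -- quarter; marking asks for half of a nonempty list.
    W-unmarked : ∀ {j s w} → j < s → W s w → ¬ Marked j w
    W-unmarked {j} {s} {w} j<s w∈W marked = <-irrefl refl (begin-strict
      2 * l                          <⟨ +-monoˡ-< _ positive ⟩
      2 * l + 2 * l                  ≤⟨ +-mono-≤ twice twice ⟩
      4 * c + 4 * c                  ≤⟨ +-mono-≤ quarter quarter ⟩
      l + l                          ≡⟨ cong (l +_) (+-identityʳ l) ⟨
      2 * l                          ∎)
      where
      open ≤-Reasoning
      l = length (T (n j))
      c = cnt (T (n j)) A w
      positive : 0 < 2 * l
      positive = ≤-trans (T-nonempty (n j)) (m≤m+n l _)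
      quarter : 4 * c ≤ l
      quarter = ≤-trans (*-monoʳ-≤ 4 (cnt-mono (T (n j)) {A} {O j} {w} {w} (coloured-nearby j<s w∈W)))
        (≤-trans (bound (few-old j) w) (≤-reflexive (*-identityˡ l)))
      half : ⌈ l /2⌉ ≤ c
      half = atLeast⇒≤cnt _ (T (n j)) marked
      twice : 2 * l ≤ 4 * c
      twice = begin
        2 * l                            ≡⟨ cong (2 *_) (⌊n/2⌋+⌈n/2⌉≡n l) ⟨
        2 * (⌊ l /2⌋ + ⌈ l /2⌉)          ≤⟨ *-monoʳ-≤ 2 (+-mono-≤ (≤-trans (⌊n/2⌋≤⌈n/2⌉ l) half) half) ⟩
        2 * (c + c)                      ≡⟨ cong (λ k → 2 * (c + k)) (+-identityʳ c) ⟨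
        2 * (2 * c)                      ≡⟨ *-assoc 2 2 c ⟨
        4 * c                            ∎

    Signal : ℕ → Pred Carrier ℓ
    Signal s z = Marked s z × (∀ j → j < s → ¬ Marked j z)

    W⊆signal : ∀ s → W s ⊆ Signal s
    W⊆signal s w∈W = W⊆marked s w∈W , λ j j<s → W-unmarked j<s w∈W

    signal-unique : ∀ {i j z} → Signal i z → Signal j z → i ≡ j
    signal-unique {i} {j} (mi , ¬i) (mj , ¬j) with <-cmp i j
    ... | tri< i<j _ _ = contradiction mi (¬j i i<j)
    ... | tri≈ _ eq _  = eq
    ... | tri> _ _ j<i = contradiction mj (¬i j j<i)

    -- The map `π` lets the same argument serve the Borel sets of `X` and, after a translation, the
    -- σ-algebra generated by the pieces on `D`.
    module _ (M : MeasurableSpace ℓ) (π : MeasurableSpace.Carrier M → Carrier)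
      (A-measurable : ∀ t → MeasurableSpace.Measurable M (λ x → A (t · π x))) where

      open MeasurableSpace M using (Measurable; measurable-⊤; measurable-∁)
      open Measurability em M

      atLeast-measurable : ∀ k T → Measurable (λ x → AtLeast k T A (π x))
      atLeast-measurable zero    T       = measurable-⊤
      atLeast-measurable (suc k) []      = measurable-∅
      atLeast-measurable (suc k) (t ∷ T) = measurable-∪
        (measurable-∩ (A-measurable t) (atLeast-measurable k T)) (atLeast-measurable (suc k) T)

      signal-measurable : ∀ s → Measurable (λ x → Signal s (π x))
      signal-measurable s = measurable-∩ (marked s) (measurable-⋂ unmarked)
        where
        marked : ∀ j → Measurable (λ x → Marked j (π x))
        marked j = atLeast-measurable ⌈ length (T (n j)) /2⌉ (T (n j))
        unmarked : ∀ j → Measurable (λ x → j < s → ¬ Marked j (π x))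
        unmarked j with j <? s
        ... | yes j<s = MeasurableSpace.measurable-≐ M ((λ h _ → h) , (λ h → h j<s)) (measurable-∁ (marked j))
        ... | no  j≮s = MeasurableSpace.measurable-≐ M ((λ _ j<s → contradiction j<s j≮s) , _) measurable-⊤

    -- The set `B` and the invariant comeager set `D`.

    -- The records sit on the sets `Signal s`, which contain `W s`, are pairwise disjoint and are
    -- determined by `A`; so records of different stages do not interfere.
    B : Pred Carrier ℓ
    B = ⋃ ℕ λ s → Signal s ∩ (g s ⁻¹ ·_) ⊢ base (index s)

    open Measurability em (borel X)

    A-borel : A ∈ σ⟨ IsOpen ⟩
    A-borel = σ-⋃ λ s → measurable-∩ (generator (⟪⟫-open (T (n s)) (W-open s)))
      (σ-∁ (generator (open-∪ (O-open s) (⟪⟫-open (K s) (W-open s)))))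

    B-borel : B ∈ σ⟨ IsOpen ⟩
    B-borel = σ-⋃ λ s → measurable-∩
      (signal-measurable (borel X) (λ x → x) (λ t → borel-preimage X X (continuous t) A-borel) s)
      (generator (continuous (g s ⁻¹) (base-open (index s))))

    V : ℕ → Pred Carrier ℓ
    V ν = ⋃ (Lift ℓ (∃ λ s → index s ≡ ν)) λ i x → let s = proj₁ (lower i) in W s (g s · x)

    V-open : ∀ ν → IsOpen (V ν)
    V-open ν = open-⋃ λ i → let s = proj₁ (lower i) in continuous (g s) (W-open s)

    D : Pred Carrier ℓ
    D x = ∀ h ν → V ν (h · x)

    D-invariant : Invariant D
    D-invariant g x∈D h ν = open-resp (V-open ν) (∙-act h g _) (x∈D (h ∙ g) ν)

    -- The enumeration `γ` turns the quantifier over the group, which makes `D` invariant, into a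
    -- countable intersection.
    D-enumerated : (λ x → ∀ n ν → V ν (γ n · x)) ≐ D
    D-enumerated = (λ x∈D h ν → let n , γn≈h = γ-surjective h in
                     open-resp (V-open ν) (·-cong γn≈h ≈-refl) (x∈D n ν)) , λ x∈D n → x∈D (γ n)

    D-borel : D ∈ σ⟨ IsOpen ⟩
    D-borel = σ-≐ D-enumerated (measurable-⋂ λ n → measurable-⋂ λ ν → generator (continuous (γ n) (V-open ν)))

    -- Signals are disjoint, so the stage that put `g s · x` into `B` is `s` itself.
    decode : ∀ {x ν s} → index s ≡ ν → (Signal s ∩ B) (g s · x) → base ν x
    decode {x} {ν} {s} refl (x∈s , s′ , x∈s′ , hit) with refl ← signal-unique {s} {s′} x∈s x∈s′ =
      open-resp (base-open (index s)) (⁻¹-·-cancel (g s) x) hit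

    -- Membership in `D`, taken at `ε`, provides a stage of index `ν` that sends `x` into its `W`.
    encode : ∀ {x ν} → D x → base ν x → ∃ λ s → index s ≡ ν × (Signal s ∩ B) (g s · x)
    encode {x} {ν} x∈D x∈U with lift (s , refl) , εx∈W ← x∈D ε ν =
      s , refl , signal , s , signal , open-resp (base-open (index s)) (≈-sym (⁻¹-·-cancel (g s) x)) x∈U
      where
      signal : Signal s (g s · x)
      signal = W⊆signal s (open-resp (W-open s) (·-congˡ (ε-act x)) εx∈W)

    module _ (base-refines : ∀ {U x} → IsOpen U → x ∈ U → ∃ λ i → x ∈ base i × base i ⊆ U) where

      -- A basic set inside `U` and the index `ν` are paired at some stage, which moves a point of
      -- that basic set into its `W`.
      V-dense : ∀ ν {U x} → IsOpen U → x ∈ U → ∃ λ v → v ∈ U × v ∈ V ν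
      V-dense ν {U} {x} oU x∈U with i , x∈i , i⊆U ← base-refines oU x∈U with s , eq ← unpair-surjective i ν
        with v , v∈ , gv∈W ← hits s (x , subst (λ i → base i x) (≡.sym (cong proj₁ eq)) x∈i)
        = v , i⊆U (subst (λ i → base i v) (cong proj₁ eq) v∈) , lift (s , cong proj₂ eq) , gv∈W

      D-comeager : Comeager X D
      D-comeager = missing , nowhere-dense , (to , λ (k , x∉V) x∈D → x∉V (x∈D (γ (proj₁ (unpair k))) (proj₂ (unpair k))))
        where
        good missing : ℕ → Pred Carrier ℓ
        good k = (γ (proj₁ (unpair k)) ·_) ⊢ V (proj₂ (unpair k))
        missing k = ∁ (good k)
        nowhere-dense : ∀ k → NowhereDense X (missing k)
        nowhere-dense k x (U , oU , x∈U , U⊆closure)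
          -- The translate of `U` by this group element meets a dense open set; pulled back, the
          -- common point lies in `U` and has the neighbourhood `good k` disjoint from `missing k`.
          with v , v∈ , v∈V ← V-dense (proj₂ (unpair k)) (continuous (γ (proj₁ (unpair k)) ⁻¹) oU)
                 (open-resp oU (≈-sym (⁻¹-·-cancel (γ (proj₁ (unpair k))) x)) x∈U)
          with w , w∈V , w∉V ← U⊆closure v∈ (continuous (γ (proj₁ (unpair k))) (V-open (proj₂ (unpair k))))
                 (open-resp (V-open (proj₂ (unpair k))) (≈-sym (·-⁻¹-cancel (γ (proj₁ (unpair k))) v)) v∈V)
          = w∉V w∈V
        to : ∁ D ⊆ ⋃ ℕ missing
        to x∉D = by-contradiction λ h → x∉D (proj₁ D-enumerated λ n ν → by-contradiction λ x∉V →
          let k , eq = unpair-surjective n ν in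
          h (k , subst (λ (n , ν) → ¬ V ν (γ n · _)) (≡.sym eq) x∉V))

    -- The four pieces and the σ-algebra that they generate.

    side : Fin 2 → Pred Carrier ℓ → Pred Carrier ℓ
    side zero       P = P
    side (suc zero) P = ∁ P

    side-unique : ∀ i j {P x} → side i P x → side j P x → i ≡ j
    side-unique zero       zero       p q = refl
    side-unique zero       (suc zero) p q = contradiction p q
    side-unique (suc zero) zero       p q = contradiction q p
    side-unique (suc zero) (suc zero) p q = refl

    side-total : ∀ P x → ∃ λ i → side i P x
    side-total P x with em {P = P x}
    ... | yes p = zero , p
    ... | no ¬p = suc zero , ¬p

    side-borel : ∀ i {P} → P ∈ σ⟨ IsOpen ⟩ → side i P ∈ σ⟨ IsOpen ⟩
    side-borel zero       mP = mP
    side-borel (suc zero) mP = σ-∁ mP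

    pieceᴬᴮ : Fin 2 × Fin 2 → Pred Carrier ℓ
    pieceᴬᴮ (i , j) = side i A ∩ side j B

    -- The binary digits of `k` choose the sides of `A` and `B`: pieces 0 and 1 make up `A`, pieces
    -- 0 and 2 make up `B`.
    piece : Fin 4 → Pred Carrier ℓ
    piece k = pieceᴬᴮ (remQuot 2 k)

    piece-combine : ∀ i j {x} → side i A x → side j B x → piece (combine i j) x
    piece-combine i j x∈A x∈B = subst (λ ij → pieceᴬᴮ ij _) (≡.sym (remQuot-combine {2} {2} i j)) (x∈A , x∈B)

    piece-borel : ∀ k → piece k ∈ σ⟨ IsOpen ⟩
    piece-borel k = measurable-∩ (side-borel (proj₁ (remQuot {2} 2 k)) A-borel) (side-borel (proj₂ (remQuot {2} 2 k)) B-borel)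

    A-pieces : (piece zero ∪ piece (suc zero)) ≐ A
    A-pieces = (λ { (inj₁ p) → proj₁ p ; (inj₂ p) → proj₁ p }) , λ {x} x∈A → case side-total B x of λ where
      (zero     , x∈B) → inj₁ (x∈A , x∈B)
      (suc zero , x∉B) → inj₂ (x∈A , x∉B)

    B-pieces : (piece zero ∪ piece (suc (suc zero))) ≐ B
    B-pieces = (λ { (inj₁ p) → proj₂ p ; (inj₂ p) → proj₂ p }) , λ {x} x∈B → case side-total A x of λ where
      (zero     , x∈A) → inj₁ (x∈A , x∈B)
      (suc zero , x∉A) → inj₂ (x∉A , x∈B)

    DSpace : MeasurableSpace ℓ
    DSpace = subspace (borel X) D

    open MeasurableSpace DSpace using () renaming (Carrier to ∣D∣; Measurable to Trace)

    pieceᴰ : Fin 4 → Pred ∣D∣ ℓ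
    pieceᴰ k = proj₁ ⊢ piece k

    αᴰ : GroupAction G (subsetoid setoid D)
    αᴰ = restrict α D-invariant

    Generated : Pred (Pred ∣D∣ ℓ) (Level.suc ℓ)
    Generated = σ⟨ Translates DSpace αᴰ pieceᴰ ⟩

    generatedSpace : MeasurableSpace ℓ
    generatedSpace = record
      { setoid       = subsetoid setoid D
      ; Measurable   = Generated
      ; measurable-≐ = σ-≐
      ; measurable-⊤ = σ-⊤
      ; measurable-∁ = σ-∁
      ; measurable-⋃ = σ-⋃
      }

    translate-piece : ∀ h k → GroupAction.translate αᴰ h (pieceᴰ k) ≐ (λ x → piece k (h ⁻¹ · proj₁ x))
    translate-piece h k =
      (λ (x , x∈ , y≈hx) → borel-resp X (piece-borel k) (≈-sym (≈-trans (·-congˡ y≈hx) (⁻¹-·-cancel h (proj₁ x)))) x∈) ,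
      λ {y} h⁻¹y∈ → (h ⁻¹ · proj₁ y , D-invariant (h ⁻¹) (proj₂ y)) , h⁻¹y∈ , ≈-sym (·-⁻¹-cancel h _)

    piece-generated : ∀ h k → (λ x → piece k (h · proj₁ x)) ∈ Generated
    piece-generated h k = generator (h ⁻¹ , k ,
      (λ {x} hx∈ → proj₂ (translate-piece (h ⁻¹) k) {x} (borel-resp X (piece-borel k) (≈-sym h⁻¹⁻¹) hx∈)) ,
      (λ {x} x∈ → borel-resp X (piece-borel k) h⁻¹⁻¹ (proj₁ (translate-piece (h ⁻¹) k) {x} x∈)))
      where
      h⁻¹⁻¹ : ∀ {x} → h ⁻¹ ⁻¹ · x ≈ h · x
      h⁻¹⁻¹ = ≈-trans (·-congˡ (≈-sym (⁻¹-·-cancel h _))) (⁻¹-·-cancel (h ⁻¹) _)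

    module GM = Measurability em generatedSpace

    A-generated : ∀ h → (λ x → A (h · proj₁ x)) ∈ Generated
    A-generated h = σ-≐ (proj₁ A-pieces , proj₂ A-pieces)
      (GM.measurable-∪ (piece-generated h zero) (piece-generated h (suc zero)))

    B-generated : ∀ h → (λ x → B (h · proj₁ x)) ∈ Generated
    B-generated h = σ-≐ (proj₁ B-pieces , proj₂ B-pieces)
      (GM.measurable-∪ (piece-generated h zero) (piece-generated h (suc (suc zero))))

    signal-generated : ∀ s h → (λ x → Signal s (h · proj₁ x)) ∈ Generated
    signal-generated s h = signal-measurable generatedSpace (λ x → h · proj₁ x) (λ t →
      σ-≐ ((λ {x} → borel-resp X A-borel (∙-act t h (proj₁ x))) , λ {x} → borel-resp X A-borel (≈-sym (∙-act t h (proj₁ x)))) (A-generated (t ∙ h))) s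

    -- By `decode` and `encode`, a basic set on `D` is the countable union, over the stages of index
    -- `ν`, of preimages of `Signal s ∩ B` under `g s`.
    base-generated : ∀ ν → (proj₁ ⊢ base ν) ∈ Generated
    base-generated ν = σ-≐ ((λ (s , eq , h) → decode eq h) , λ {x} x∈U → encode (proj₂ x) x∈U)
      (σ-⋃ λ s → decoded s)
      where
      decoded : ∀ s → (λ x → index s ≡ ν × (Signal s ∩ B) (g s · proj₁ x)) ∈ Generated
      decoded s with index s ≟ ν
      ... | yes eq = σ-≐ ((λ h → eq , h) , proj₂) (GM.measurable-∩ (signal-generated s (g s)) (B-generated (g s)))
      ... | no ¬eq = σ-≐ ((λ ()) , λ h → contradiction (proj₁ h) ¬eq) GM.measurable-∅

    trace-translates : Generated ⊆ Trace
    trace-translates (generator (h , k , eq)) =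
      MeasurableSpace.measurable-≐ DSpace (≐-sym (≐-trans eq (translate-piece h k)))
        ((h ⁻¹ ·_) ⊢ piece k , borel-preimage X X (continuous (h ⁻¹)) (piece-borel k) , ≐-refl)
    trace-translates (σ-≐ eq mP) = MeasurableSpace.measurable-≐ DSpace eq (trace-translates mP)
    trace-translates σ-⊤         = MeasurableSpace.measurable-⊤ DSpace
    trace-translates (σ-∁ mP)    = MeasurableSpace.measurable-∁ DSpace (trace-translates mP)
    trace-translates (σ-⋃ mP)    = MeasurableSpace.measurable-⋃ DSpace (λ n → trace-translates (mP n))

    module _ (base-refines : ∀ {U x} → IsOpen U → x ∈ U → ∃ λ i → x ∈ base i × base i ⊆ U) where

      borel-generated : ∀ {P} → P ∈ σ⟨ IsOpen ⟩ → (proj₁ ⊢ P) ∈ Generated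
      -- An open set is the union over all `i` of `base i` cut with the constant set given by the
      -- truth of `base i ⊆ P`.
      borel-generated {P} (generator oP) = σ-≐
        ((λ (i , x∈i , i⊆P) → i⊆P x∈i) , λ {x} x∈P → let i , x∈i , i⊆P = base-refines oP x∈P in i , x∈i , λ {y} → i⊆P {y})
        (σ-⋃ λ i → GM.measurable-∩ (base-generated i) (GM.measurable-const (base i ⊆ P)))
      borel-generated (σ-≐ (P⊆Q , Q⊆P) mP) = σ-≐ (P⊆Q , Q⊆P) (borel-generated mP)
      borel-generated σ-⊤                  = σ-⊤
      borel-generated (σ-∁ mP)             = σ-∁ (borel-generated mP)
      borel-generated (σ-⋃ mP)             = σ-⋃ (λ n → borel-generated (mP n))

      hasGenerator : HasGenerator DSpace αᴰ 4
      hasGenerator = pieceᴰ , record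
        { measurable = λ k → piece k , piece-borel k , ≐-refl
        ; disjoint   = λ {k} {l} k≢l (p , q) → contradiction (unique k l p q) k≢l
        ; covering   = λ (x , _) → let i , x∈A = side-total A x ; j , x∈B = side-total B x in
                         combine i j , piece-combine i j x∈A x∈B
        ; generates  = trace-translates , λ (P , mP , eq) → σ-≐ (≐-sym eq) (borel-generated mP)
        }
        where
        unique : ∀ k l {x} → piece k x → piece l x → k ≡ l
        unique k l (a , b) (a′ , b′) = ≡.trans (≡.sym (combine-remQuot {2} 2 k)) (≡.trans
          (cong₂ combine (side-unique (proj₁ (remQuot {2} 2 k)) (proj₁ (remQuot {2} 2 l)) a a′)
                         (side-unique (proj₂ (remQuot {2} 2 k)) (proj₂ (remQuot {2} 2 l)) b b′))
          (combine-remQuot {2} 2 l))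

-- Rational radii and a countable base of a Polish space.

rational-gap : ∀ {p q} → p ℚ.< q → ∃ λ δ → 0ℚ ℚ.< δ × p ℚ.+ δ ≡ q
rational-gap {p} {q} p<q = q ℚ.- p , subst (ℚ._< q ℚ.- p) (ℚ.+-inverseʳ p) (ℚ.+-monoˡ-< (ℚ.- p) p<q) ,
  ≡.trans (ℚ.+-comm p (q ℚ.- p)) (≡.trans (ℚ.+-assoc q (ℚ.- p) p)
    (≡.trans (cong (q ℚ.+_) (ℚ.+-inverseˡ p)) (ℚ.+-identityʳ q)))

rational-half : ∀ {q} → 0ℚ ℚ.< q → ∃ λ δ → 0ℚ ℚ.< δ × δ ℚ.+ δ ≡ q
rational-half {q} 0<q = ½ ℚ.* q , subst (ℚ._< ½ ℚ.* q) (ℚ.*-zeroʳ ½) (ℚ.*-monoʳ-<-pos ½ 0<q) ,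
  ≡.trans (≡.sym (ℚ.*-distribʳ-+ q ½ ½)) (ℚ.*-identityˡ q)

fraction : ℕ × ℕ → ℚ
fraction (m , n) = ℤ.+ m ℚ./ suc n

fraction-surjective : ∀ {q} → 0ℚ ℚ.< q → ∃₂ λ m n → fraction (m , n) ≡ q
-- A rational stores its denominator minus one, which is what `fraction` expects.
fraction-surjective {q@(mkℚ (ℤ.+ m) n _)} 0<q = m , n , ℚ.↥p/↧p≡p q
fraction-surjective {mkℚ ℤ.-[1+ _ ] _ _} 0<q with () ← ℚ.drop-*<* 0<q

module Polish (em : ∀ {a} → ExcludedMiddle a) {ℓ} (X : TopologicalSpace ℓ) (polish : IsPolish X) where

  open Classical em
  open TopologicalSpace X using (Carrier; _≈_; IsOpen) renaming (refl to ≈-refl)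
  open IsPolish polish
  module Metric′ = Metric metric
  open Metric′ using (d; isGeneralMetric)
  open IsGeneralMetric isGeneralMetric using () renaming (cong to d-cong)

  d-triangle : ∀ {x y z p q r} → d x y <ᵣ p → d y z <ᵣ q → p ℚ.+ q ≡ r → d x z <ᵣ r
  d-triangle {x} {y} {z} dxy<p dyz<q p+q≡r = Metric′.triangle x y z (_ , _ , dxy<p , dyz<q , ℚ.≤-reflexive p+q≡r)

  d-sym : ∀ {x y p} → d x y <ᵣ p → d y x <ᵣ p
  d-sym {x} {y} = proj₁ (Metric′.sym x y)

  ball : Carrier → ℚ → Pred Carrier ℓ
  ball x ε y = Lift ℓ (d x y <ᵣ ε)

  metric-open : ∀ {U} → (∀ {x} → x ∈ U → ∃ λ ε → 0ℚ ℚ.< ε × (∀ {y} → d x y <ᵣ ε → y ∈ U)) → IsOpen U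
  metric-open {U} h = Equivalence.from (compatible U) h

  ball-contains-ball : ∀ {x ε y} → d x y <ᵣ ε → ∃ λ δ → 0ℚ ℚ.< δ × (∀ {z} → d y z <ᵣ δ → d x z <ᵣ ε)
  ball-contains-ball {x} {ε} {y} dxy<ε with p , p<ε , dxy<p ← ℝ≥0.rounded (d x y) dxy<ε
    with δ , 0<δ , p+δ≡ε ← rational-gap p<ε = δ , 0<δ , λ dyz<δ → d-triangle dxy<p dyz<δ p+δ≡ε

  ball-open : ∀ x ε → IsOpen (ball x ε)
  ball-open x ε = metric-open λ (lift dxy<ε) → let δ , 0<δ , sub = ball-contains-ball dxy<ε in
    δ , 0<δ , λ dyz<δ → lift (sub dyz<δ)

  ball-centre : ∀ {x ε} → 0ℚ ℚ.< ε → d x x <ᵣ ε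
  ball-centre = proj₂ (Metric′.≈⇒0 ≈-refl)

  -- Some positive `ε` is not above the distance of distinct points, and balls of radius `ε / 2` are
  -- then disjoint.
  hausdorff : ∀ {x y} → ¬ x ≈ y → ∃₂ λ U V →
              IsOpen U × IsOpen V × x ∈ U × y ∈ V × (∀ {z} → z ∈ U → ¬ z ∈ V)
  hausdorff {x} {y} x≉y
    with ε , 0<ε , dxy≮ε ← by-contradiction {P = ∃ λ ε → 0ℚ ℚ.< ε × ¬ d x y <ᵣ ε} (λ h → x≉y (Metric′.0⇒≈
           (ℝ≥0.positive (d x y) , λ {ε} 0<ε → by-contradiction λ dxy≮ε → h (ε , 0<ε , dxy≮ε))))
    with δ , 0<δ , δ+δ≡ε ← rational-half 0<ε
    = ball x δ , ball y δ , ball-open x δ , ball-open y δ , lift (ball-centre 0<δ) , lift (ball-centre 0<δ) ,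
      λ (lift dxz<δ) (lift dyz<δ) → dxy≮ε (d-triangle dxz<δ (d-sym dyz<δ) δ+δ≡ε)

  Q = proj₁ separable
  open Injection (proj₁ (proj₂ separable)) using (to; injective)

  -- The index codes a centre and a radius. Quantifying over the centres with a given code makes the
  -- set empty when the number codes none.
  base : ℕ → Pred Carrier ℓ
  base i y = let n , k = unpair i in ∃ λ (c : Σ Carrier Q) → to c ≡ n × d (proj₁ c) y <ᵣ fraction (unpair k)

  base-open : ∀ i → IsOpen (base i)
  base-open i = metric-open λ (c , eq , dcy<ρ) → let δ , 0<δ , sub = ball-contains-ball dcy<ρ in
    δ , 0<δ , λ dyz<δ → c , eq , sub dyz<δ

  base-refines : ∀ {U x} → IsOpen U → x ∈ U → ∃ λ i → x ∈ base i × base i ⊆ U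
  base-refines {U} {x} oU x∈U
    with ε , 0<ε , sub ← Equivalence.to (compatible U) oU x∈U
    with δ , 0<δ , δ+δ≡ε ← rational-half 0<ε
    with c , lift dxc<δ , c∈Q ← proj₂ (proj₂ separable) x (ball-open x δ) (lift (ball-centre 0<δ))
    with m , n , ρ≡δ ← fraction-surjective 0<δ
    with k , k≡ ← unpair-surjective m n
    with i , i≡ ← unpair-surjective (to (c , c∈Q)) k
    = i , ((c , c∈Q) , ≡.sym (cong proj₁ i≡) , subst (d c x <ᵣ_) (≡.sym radius) (d-sym dxc<δ)) ,
      -- Equal codes give `c′ ≈ c`, and a `δ`-ball around a centre within `δ` of `x` stays inside
      -- the `ε`-ball around `x`.
      λ { {y} ((c′ , c′∈Q) , eq , dc′y<ρ) → sub (d-triangle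
        (proj₁ (d-cong ≈-refl (injective (≡.trans (cong proj₁ i≡′) (≡.sym eq)))) dxc<δ)
        (subst (d c′ y <ᵣ_) radius dc′y<ρ) δ+δ≡ε) }
    where
    i≡′ : (to (c , c∈Q) , k) ≡ unpair i
    i≡′ = ≡.sym i≡
    radius : fraction (unpair (proj₂ (unpair i))) ≡ δ
    radius = ≡.trans (cong (fraction ∘ unpair ∘ proj₂) i≡) (≡.trans (cong fraction k≡) ρ≡δ)

-- Continuity of single translations, and the conclusion.

-- Joint continuity puts an open box around each `(g , x)` with `g · x` in `U`; the second sides of
-- the boxes have the preimage of `U` as their union.
translation-continuous : ∀ {ℓ} {G : Group ℓ ℓ} (X : PolishGSpace G) (let open PolishGSpace X) →
                         ∀ g → Continuous space space (GroupAction._·_ action g)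
translation-continuous {G = G} X g {U} oU = open-≐ (to , from) (open-⋃ λ (x , gx∈U) → nbhd-open gx∈U)
  where
  open PolishGSpace X using (space; continuous)
  open TopologicalSpace space
  open GroupAction (PolishGSpace.action X)
  nbhd : ∀ {x} → g · x ∈ U → Pred Carrier _
  nbhd gx∈U = proj₁ (proj₂ (continuous oU gx∈U))
  nbhd-open : ∀ {x} (gx∈U : g · x ∈ U) → IsOpen (nbhd gx∈U)
  nbhd-open gx∈U = let _ , _ , _ , oV , _ = continuous oU gx∈U in oV
  to : ⋃ (Σ Carrier ((g ·_) ⊢ U)) (nbhd ∘ proj₂) ⊆ (g ·_) ⊢ U
  to ((_ , gx∈U) , y∈V) = let _ , _ , _ , _ , g∈H , _ , sub = continuous oU gx∈U in sub g∈H y∈V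
  from : (g ·_) ⊢ U ⊆ ⋃ (Σ Carrier ((g ·_) ⊢ U)) (nbhd ∘ proj₂)
  from gx∈U = let _ , _ , _ , _ , _ , x∈V , _ = continuous oU gx∈U in (_ , gx∈U) , x∈V

theorem10p1 : (∀ {a} → ExcludedMiddle a) →
    ∀ {ℓ} (G : Group ℓ ℓ) → CountablyInfinite (Group.setoid G) →
    (X : PolishGSpace G) → (let open PolishGSpace X) → Aperiodic →
    Σ[ D ∈ Pred Carrier ℓ ] Σ[ invariant ∈ Invariant D ]
    (D ∈ MeasurableSpace.Measurable (borel space)) ×
    Comeager space D ×
    HasGenerator (subspace (borel space) D) (restrict action invariant) 4
theorem10p1 em G countable X aperiodic =
  D , D-invariant , D-borel , D-comeager base-refines , hasGenerator base-refines
  where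
  open PolishGSpace X using (space; isPolish; action)
  open Polish em space isPolish
  module C = Bijection countable
  open Construction em G space action hausdorff (translation-continuous X)
    -- The inverse of the given bijection enumerates the group; by injectivity `g` is reached at
    -- `C.to g`.
    C.to⁻ (λ g → C.to g , C.injective (proj₂ (C.surjective (C.to g)) (Group.refl G))) aperiodic
  open Stages base base-open
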